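{- For an integer $t$ let $\mathcal{H}_t=\mathrm{Forb}(K_{2,t})$. For all $p\in[0,1]$: (i) $$\mathrm{ed}_{\mathcal{H}_5}(p)\leq\min\left\{p(1-p),\frac{1+75p}{96},\frac{1+26p}{40},\frac{1+5p}{13},\frac16,\frac{1-p}{4}\right\}.$$ (ii) $$\mathrm{ed}_{\mathcal{H}_6}(p)\leq\min\left\{p(1-p),\frac{1+63p}{85},\frac{1+14p}{26},\frac{1+7p}{17},\frac{1+2p}{10},\frac{1-p}{5}\right\}.$$ (iii) $$\mathrm{ed}_{\mathcal{H}_7}(p)\leq\min\left\{p(1-p),\frac{1+124p}{156},\frac{1+76p}{100},\frac{1+44p}{64},\frac{1+31p}{49},\frac{1+20p}{36},\frac{1+5p}{16},\frac18,\frac{1-p}{6}\right\}.$$ (iv) $$\mathrm{ed}_{\mathcal{H}_8}(p)\leq\min\left\{p(1-p),\frac{1+124p}{156},\frac{1+95p}{125},\frac{1+53p}{76},\frac{1+20p}{36},\frac{1+11p}{25},\frac{1+5p}{16},\frac{3p+1}{13},\frac{1-p}{7}\right\}.$$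
   Context: All graphs are finite and simple. $K_{2,t}$ is the complete bipartite graph with parts of sizes $2$ and $t$. For a graph $H$, $\mathrm{Forb}(H)$ is the hereditary property consisting of all graphs with no induced subgraph isomorphic to $H$. For graphs $G,G'$ on the same labeled vertex set, $\mathrm{dist}(G,G')=|E(G)\,\Delta\, E(G')|$; for a hereditary property $\mathcal{H}$ (a set of graphs closed under isomorphism and vertex deletion), $\mathrm{dist}(G,\mathcal{H})=\min\{\mathrm{dist}(G,G'): G'\in\mathcal{H},\ V(G')=V(G)\}$. The edit distance function is $$\mathrm{ed}_{\mathcal{H}}(p)=\lim_{n\to\infty}\max\left\{\mathrm{dist}(G,\mathcal{H}): |V(G)|=n,\ |E(G)|=\left\lfloor p\tbinom n2\right\rfloor\right\}\Big/\tbinom n2,\qquad p\in[0,1].$$ (The limit is known to exist, and the function is known to be continuous and concave.) -}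

module Defs where

open import Data.Bool.Base using (Bool; true; false; _∧_; _xor_)
open import Data.Fin.Base using (Fin; punchIn; splitAt; toℕ)
open import Data.Fin.Properties using (punchIn-injective)
open import Data.Integer.Base as ℤ using (+_)
open import Data.List.Base using (List; allFin; cartesianProduct; filterᵇ; length)
open import Data.Nat.Base as ℕ using (ℕ; suc; NonZero)
open import Data.Nat.Combinatorics using (_C_)
import Data.Nat.Properties as ℕ
open import Data.Product.Base using (Σ; ∃; _×_; _,_)
open import Data.Rational.Base as ℚ using (ℚ; 0ℚ; 1ℚ; ½; ∣_∣)
import Data.Rational.Properties as ℚ
open import Data.Rational.Solver using (module +-*-Solver)
open import Data.Sum.Base using (_⊎_; inj₁; inj₂)
open import Function.Base using (_∘_)
open import Function.Bundles using (_↔_; module Inverse)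
open import Function.Definitions using (Injective)
open import Relation.Binary.PropositionalEquality
open import Relation.Nullary.Negation.Core using (¬_)

-- Real numbers, as Cauchy sequences of rationals.  Equality is not _≡_;
-- everything below only uses the order relations _≤_ and _<_.

IsCauchy : (ℕ → ℚ) → Set
IsCauchy a = ∀ ε → 0ℚ ℚ.< ε →
  ∃ λ N → ∀ m n → N ℕ.≤ m → N ℕ.≤ n → ∣ a m ℚ.- a n ∣ ℚ.< ε

record ℝ : Set where
  constructor mkℝ
  field
    seq    : ℕ → ℚ
    cauchy : IsCauchy seq

open ℝ public

private
  p≤∣p∣ : ∀ p → p ℚ.≤ ∣ p ∣
  p≤∣p∣ p with ℚ.≤-total 0ℚ p
  ... | inj₁ 0≤p = ℚ.≤-reflexive (sym (ℚ.0≤p⇒∣p∣≡p 0≤p))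
  ... | inj₂ p≤0 = ℚ.≤-trans p≤0 (ℚ.nonNegative⁻¹ ∣ p ∣ {{ℚ.∣-∣-nonNeg p}})

  -- Since m and n play symmetric roles, a one-sided bound is enough.
  oneSided : (a : ℕ → ℚ) →
    (∀ ε → 0ℚ ℚ.< ε →
      ∃ λ N → ∀ m n → N ℕ.≤ m → N ℕ.≤ n → a m ℚ.< a n ℚ.+ ε) →
    IsCauchy a
  oneSided a h ε 0<ε with h ε 0<ε
  ... | N , close = N , bound
    where
    open +-*-Solver
    diff : ∀ m n → N ℕ.≤ m → N ℕ.≤ n → a m ℚ.- a n ℚ.< ε
    diff m n N≤m N≤n = subst (a m ℚ.- a n ℚ.<_)
      (solve 2 (λ x e → x :+ e :- x := e) refl (a n) ε)
      (ℚ.+-monoˡ-< (ℚ.- a n) (close m n N≤m N≤n))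
    bound : ∀ m n → N ℕ.≤ m → N ℕ.≤ n → ∣ a m ℚ.- a n ∣ ℚ.< ε
    bound m n N≤m N≤n with ℚ.∣p∣≡p∨∣p∣≡-p (a m ℚ.- a n)
    ... | inj₁ eq = subst (ℚ._< ε) (sym eq) (diff m n N≤m N≤n)
    ... | inj₂ eq = subst (ℚ._< ε)
      (sym (trans eq (solve 2 (λ x y → :- (x :- y) := y :- x) refl (a m) (a n))))
      (diff n m N≤n N≤m)

  upper : ∀ {ε} p q → ∣ p ℚ.- q ∣ ℚ.< ε → p ℚ.< q ℚ.+ ε
  upper {ε} p q lt = subst (ℚ._< q ℚ.+ ε)
    (solve 2 (λ x y → y :+ (x :- y) := x) refl p q)
    (ℚ.+-monoʳ-< q (ℚ.≤-<-trans (p≤∣p∣ (p ℚ.- q)) lt))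
    where open +-*-Solver

  halve : ∀ ε → ½ ℚ.* ε ℚ.+ ½ ℚ.* ε ≡ ε
  halve ε = trans (sym (ℚ.*-distribʳ-+ ε ½ ½)) (ℚ.*-identityˡ ε)

  half-pos : ∀ {ε} → 0ℚ ℚ.< ε → 0ℚ ℚ.< ½ ℚ.* ε
  half-pos {ε} 0<ε = subst (ℚ._< ½ ℚ.* ε) (ℚ.*-zeroʳ ½) (ℚ.*-monoʳ-<-pos ½ 0<ε)

  +-cauchy : ∀ {a b} → IsCauchy a → IsCauchy b → IsCauchy (λ n → a n ℚ.+ b n)
  +-cauchy {a} {b} ca cb ε 0<ε
    with ca (½ ℚ.* ε) (half-pos 0<ε) | cb (½ ℚ.* ε) (half-pos 0<ε)
  ... | M , ha | N , hb = M ℕ.⊔ N , bound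
    where
    open +-*-Solver
    open ℚ.≤-Reasoning
    bound : ∀ m n → M ℕ.⊔ N ℕ.≤ m → M ℕ.⊔ N ℕ.≤ n →
            ∣ (a m ℚ.+ b m) ℚ.- (a n ℚ.+ b n) ∣ ℚ.< ε
    bound m n p q = begin-strict
      ∣ (a m ℚ.+ b m) ℚ.- (a n ℚ.+ b n) ∣
        ≡⟨ cong ∣_∣ (solve 4 (λ x y z w → (x :+ y) :- (z :+ w) := (x :- z) :+ (y :- w))
             refl (a m) (b m) (a n) (b n)) ⟩
      ∣ (a m ℚ.- a n) ℚ.+ (b m ℚ.- b n) ∣
        ≤⟨ ℚ.∣p+q∣≤∣p∣+∣q∣ (a m ℚ.- a n) (b m ℚ.- b n) ⟩
      ∣ a m ℚ.- a n ∣ ℚ.+ ∣ b m ℚ.- b n ∣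
        <⟨ ℚ.+-mono-< (ha m n (ℕ.m⊔n≤o⇒m≤o M N p) (ℕ.m⊔n≤o⇒m≤o M N q))
                      (hb m n (ℕ.m⊔n≤o⇒n≤o M N p) (ℕ.m⊔n≤o⇒n≤o M N q)) ⟩
      ½ ℚ.* ε ℚ.+ ½ ℚ.* ε
        ≡⟨ halve ε ⟩
      ε ∎

  neg-cauchy : ∀ {a} → IsCauchy a → IsCauchy (λ n → ℚ.- a n)
  neg-cauchy {a} ca ε 0<ε with ca ε 0<ε
  ... | N , h = N , λ m n p q → subst (ℚ._< ε)
    (cong ∣_∣ (solve 2 (λ x y → y :- x := (:- x) :- (:- y)) refl (a m) (a n)))
    (h n m q p)
    where open +-*-Solver

  ⊓-cauchy : ∀ {a b} → IsCauchy a → IsCauchy b → IsCauchy (λ n → a n ℚ.⊓ b n)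
  ⊓-cauchy {a} {b} ca cb = oneSided (λ n → a n ℚ.⊓ b n) h
    where
    h : ∀ ε → 0ℚ ℚ.< ε → ∃ λ N → ∀ m n → N ℕ.≤ m → N ℕ.≤ n →
        a m ℚ.⊓ b m ℚ.< (a n ℚ.⊓ b n) ℚ.+ ε
    h ε 0<ε with ca ε 0<ε | cb ε 0<ε
    ... | M , ha | N , hb = M ℕ.⊔ N , bound
      where
      bound : ∀ m n → M ℕ.⊔ N ℕ.≤ m → M ℕ.⊔ N ℕ.≤ n →
              a m ℚ.⊓ b m ℚ.< (a n ℚ.⊓ b n) ℚ.+ ε
      bound m n p q with ℚ.⊓-sel (a n) (b n)
      ... | inj₁ eq = subst (λ z → a m ℚ.⊓ b m ℚ.< z ℚ.+ ε) (sym eq)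
        (ℚ.≤-<-trans (ℚ.p⊓q≤p (a m) (b m))
          (upper (a m) (a n) (ha m n (ℕ.m⊔n≤o⇒m≤o M N p) (ℕ.m⊔n≤o⇒m≤o M N q))))
      ... | inj₂ eq = subst (λ z → a m ℚ.⊓ b m ℚ.< z ℚ.+ ε) (sym eq)
        (ℚ.≤-<-trans (ℚ.p⊓q≤q (a m) (b m))
          (upper (b m) (b n) (hb m n (ℕ.m⊔n≤o⇒n≤o M N p) (ℕ.m⊔n≤o⇒n≤o M N q))))

  abs-cauchy : ∀ {a} → IsCauchy a → IsCauchy (λ n → ∣ a n ∣)
  abs-cauchy {a} ca = oneSided (λ n → ∣ a n ∣) h
    where
    open +-*-Solver
    open ℚ.≤-Reasoning
    h : ∀ ε → 0ℚ ℚ.< ε → ∃ λ N → ∀ m n → N ℕ.≤ m → N ℕ.≤ n →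
        ∣ a m ∣ ℚ.< ∣ a n ∣ ℚ.+ ε
    h ε 0<ε with ca ε 0<ε
    ... | N , ha = N , λ m n p q → begin-strict
      ∣ a m ∣
        ≡⟨ cong ∣_∣ (solve 2 (λ x y → x := y :+ (x :- y)) refl (a m) (a n)) ⟩
      ∣ a n ℚ.+ (a m ℚ.- a n) ∣
        ≤⟨ ℚ.∣p+q∣≤∣p∣+∣q∣ (a n) (a m ℚ.- a n) ⟩
      ∣ a n ∣ ℚ.+ ∣ a m ℚ.- a n ∣
        <⟨ ℚ.+-monoʳ-< ∣ a n ∣ (ha m n p q) ⟩
      ∣ a n ∣ ℚ.+ ε ∎

  0<q+1 : ∀ q → 0ℚ ℚ.≤ q → 0ℚ ℚ.< q ℚ.+ 1ℚ
  0<q+1 q 0≤q = ℚ.≤-<-trans {0ℚ} {q} {q ℚ.+ 1ℚ} 0≤q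
    (subst (ℚ._< q ℚ.+ 1ℚ) (ℚ.+-identityʳ q) (ℚ.+-monoʳ-< q {0ℚ} {1ℚ} (ℚ.positive⁻¹ 1ℚ)))

  bounded : ∀ {a} → IsCauchy a →
    ∃ λ K → 0ℚ ℚ.< K × (∃ λ N → ∀ n → N ℕ.≤ n → ∣ a n ∣ ℚ.≤ K)
  bounded {a} ca = go (abs-cauchy {a} ca 1ℚ (ℚ.positive⁻¹ 1ℚ))
    where
    go : (∃ λ N → ∀ m n → N ℕ.≤ m → N ℕ.≤ n → ∣ ∣ a m ∣ ℚ.- ∣ a n ∣ ∣ ℚ.< 1ℚ) →
         ∃ λ K → 0ℚ ℚ.< K × (∃ λ N → ∀ n → N ℕ.≤ n → ∣ a n ∣ ℚ.≤ K)
    go (N , h) = ∣ a N ∣ ℚ.+ 1ℚ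
      , 0<q+1 ∣ a N ∣ (ℚ.nonNegative⁻¹ ∣ a N ∣ {{ℚ.∣-∣-nonNeg (a N)}})
      , N , λ n p → ℚ.<⇒≤ {∣ a n ∣} {∣ a N ∣ ℚ.+ 1ℚ}
          (upper {1ℚ} ∣ a n ∣ ∣ a N ∣ (h n N p ℕ.≤-refl))

  scaled : ∀ K → 0ℚ ℚ.< K → ∀ {b} → IsCauchy b → ∀ ε → 0ℚ ℚ.< ε →
    ∃ λ N → ∀ x m n → ∣ x ∣ ℚ.≤ K → N ℕ.≤ m → N ℕ.≤ n →
      ∣ x ℚ.* (b m ℚ.- b n) ∣ ℚ.< ε
  scaled K K>0 {b} cb ε 0<ε = go (cb δ 0<δ)
    where
    instance
      posK : ℚ.Positive K
      posK = ℚ.positive {K} K>0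
      nonNegK : ℚ.NonNegative K
      nonNegK = ℚ.pos⇒nonNeg K
      nonZeroK : ℚ.NonZero K
      nonZeroK = ℚ.pos⇒nonZero K
      pos1/K : ℚ.Positive (ℚ.1/ K)
      pos1/K = ℚ.1/pos⇒pos K
    δ : ℚ
    δ = ℚ.1/ K ℚ.* ε
    0<δ : 0ℚ ℚ.< δ
    0<δ = subst (ℚ._< δ) (ℚ.*-zeroʳ (ℚ.1/ K)) (ℚ.*-monoʳ-<-pos (ℚ.1/ K) 0<ε)
    open ℚ.≤-Reasoning
    go : (∃ λ N → ∀ m n → N ℕ.≤ m → N ℕ.≤ n → ∣ b m ℚ.- b n ∣ ℚ.< δ) →
         ∃ λ N → ∀ x m n → ∣ x ∣ ℚ.≤ K → N ℕ.≤ m → N ℕ.≤ n →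
           ∣ x ℚ.* (b m ℚ.- b n) ∣ ℚ.< ε
    go (N , h) = N , λ x m n x≤K p q → begin-strict
      ∣ x ℚ.* (b m ℚ.- b n) ∣
        ≡⟨ ℚ.∣p*q∣≡∣p∣*∣q∣ x (b m ℚ.- b n) ⟩
      ∣ x ∣ ℚ.* ∣ b m ℚ.- b n ∣
        ≤⟨ ℚ.*-monoʳ-≤-nonNeg ∣ b m ℚ.- b n ∣ {{ℚ.∣-∣-nonNeg (b m ℚ.- b n)}} x≤K ⟩
      K ℚ.* ∣ b m ℚ.- b n ∣
        <⟨ ℚ.*-monoʳ-<-pos K (h m n p q) ⟩
      K ℚ.* (ℚ.1/ K ℚ.* ε)
        ≡⟨ ℚ.*-assoc K (ℚ.1/ K) ε ⟨
      (K ℚ.* ℚ.1/ K) ℚ.* ε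
        ≡⟨ cong (ℚ._* ε) (ℚ.*-inverseʳ K) ⟩
      1ℚ ℚ.* ε
        ≡⟨ ℚ.*-identityˡ ε ⟩
      ε ∎

  *-cauchy : ∀ {a b} → IsCauchy a → IsCauchy b → IsCauchy (λ n → a n ℚ.* b n)
  *-cauchy {a} {b} ca cb ε 0<ε = go (bounded {a} ca) (bounded {b} cb)
    where
    go : (∃ λ K → 0ℚ ℚ.< K × (∃ λ N → ∀ n → N ℕ.≤ n → ∣ a n ∣ ℚ.≤ K)) →
         (∃ λ L → 0ℚ ℚ.< L × (∃ λ N → ∀ n → N ℕ.≤ n → ∣ b n ∣ ℚ.≤ L)) →
         ∃ λ N → ∀ m n → N ℕ.≤ m → N ℕ.≤ n →
           ∣ (a m ℚ.* b m) ℚ.- (a n ℚ.* b n) ∣ ℚ.< ε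
    go (K , K>0 , N₁ , ha) (L , L>0 , N₂ , hb) =
      combine (scaled K K>0 {b} cb (½ ℚ.* ε) (half-pos 0<ε))
              (scaled L L>0 {a} ca (½ ℚ.* ε) (half-pos 0<ε))
      where
      combine :
        (∃ λ N → ∀ x m n → ∣ x ∣ ℚ.≤ K → N ℕ.≤ m → N ℕ.≤ n →
          ∣ x ℚ.* (b m ℚ.- b n) ∣ ℚ.< ½ ℚ.* ε) →
        (∃ λ N → ∀ x m n → ∣ x ∣ ℚ.≤ L → N ℕ.≤ m → N ℕ.≤ n →
          ∣ x ℚ.* (a m ℚ.- a n) ∣ ℚ.< ½ ℚ.* ε) →
        ∃ λ N → ∀ m n → N ℕ.≤ m → N ℕ.≤ n →
          ∣ (a m ℚ.* b m) ℚ.- (a n ℚ.* b n) ∣ ℚ.< ε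
      combine (N₃ , hb′) (N₄ , ha′) = N , bound
        where
        open +-*-Solver
        open ℚ.≤-Reasoning
        N : ℕ
        N = (N₁ ℕ.⊔ N₂) ℕ.⊔ (N₃ ℕ.⊔ N₄)
        N₁≤ : ∀ {m} → N ℕ.≤ m → N₁ ℕ.≤ m
        N₁≤ p = ℕ.m⊔n≤o⇒m≤o N₁ N₂ (ℕ.m⊔n≤o⇒m≤o (N₁ ℕ.⊔ N₂) (N₃ ℕ.⊔ N₄) p)
        N₂≤ : ∀ {m} → N ℕ.≤ m → N₂ ℕ.≤ m
        N₂≤ p = ℕ.m⊔n≤o⇒n≤o N₁ N₂ (ℕ.m⊔n≤o⇒m≤o (N₁ ℕ.⊔ N₂) (N₃ ℕ.⊔ N₄) p)
        N₃≤ : ∀ {m} → N ℕ.≤ m → N₃ ℕ.≤ m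
        N₃≤ p = ℕ.m⊔n≤o⇒m≤o N₃ N₄ (ℕ.m⊔n≤o⇒n≤o (N₁ ℕ.⊔ N₂) (N₃ ℕ.⊔ N₄) p)
        N₄≤ : ∀ {m} → N ℕ.≤ m → N₄ ℕ.≤ m
        N₄≤ p = ℕ.m⊔n≤o⇒n≤o N₃ N₄ (ℕ.m⊔n≤o⇒n≤o (N₁ ℕ.⊔ N₂) (N₃ ℕ.⊔ N₄) p)
        bound : ∀ m n → N ℕ.≤ m → N ℕ.≤ n →
                ∣ (a m ℚ.* b m) ℚ.- (a n ℚ.* b n) ∣ ℚ.< ε
        bound m n p q = begin-strict
          ∣ (a m ℚ.* b m) ℚ.- (a n ℚ.* b n) ∣
            ≡⟨ cong ∣_∣ (solve 4 (λ x y z w → (x :* y) :- (z :* w)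
                                            := x :* (y :- w) :+ w :* (x :- z))
                 refl (a m) (b m) (a n) (b n)) ⟩
          ∣ a m ℚ.* (b m ℚ.- b n) ℚ.+ b n ℚ.* (a m ℚ.- a n) ∣
            ≤⟨ ℚ.∣p+q∣≤∣p∣+∣q∣ (a m ℚ.* (b m ℚ.- b n)) (b n ℚ.* (a m ℚ.- a n)) ⟩
          ∣ a m ℚ.* (b m ℚ.- b n) ∣ ℚ.+ ∣ b n ℚ.* (a m ℚ.- a n) ∣
            <⟨ ℚ.+-mono-< (hb′ (a m) m n (ha m (N₁≤ p)) (N₃≤ p) (N₃≤ q))
                          (ha′ (b n) m n (hb n (N₂≤ q)) (N₄≤ p) (N₄≤ q)) ⟩
          ½ ℚ.* ε ℚ.+ ½ ℚ.* ε
            ≡⟨ halve ε ⟩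
          ε ∎

fromℚ : ℚ → ℝ
fromℚ q = mkℝ (λ _ → q) λ ε 0<ε → 0 , λ _ _ _ _ →
  subst (ℚ._< ε) (cong ∣_∣ (sym (ℚ.+-inverseʳ q))) 0<ε

ι : ℕ → ℝ
ι n = fromℚ (+ n ℚ./ 1)

infixl 6 _+_ _-_
infixl 7 _*_ _/_
infixl 5 _⊓_
infix  4 _≤_ _<_

_+_ : ℝ → ℝ → ℝ
x + y = mkℝ (λ n → seq x n ℚ.+ seq y n) (+-cauchy {seq x} {seq y} (cauchy x) (cauchy y))

_-_ : ℝ → ℝ → ℝ
x - y = mkℝ (λ n → seq x n ℚ.- seq y n)
  (+-cauchy {seq x} {λ n → ℚ.- seq y n} (cauchy x) (neg-cauchy {seq y} (cauchy y)))

_*_ : ℝ → ℝ → ℝ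
x * y = mkℝ (λ n → seq x n ℚ.* seq y n) (*-cauchy {seq x} {seq y} (cauchy x) (cauchy y))

_/_ : ℝ → (d : ℕ) → .{{NonZero d}} → ℝ
x / d = x * fromℚ (+ 1 ℚ./ d)

_⊓_ : ℝ → ℝ → ℝ
x ⊓ y = mkℝ (λ n → seq x n ℚ.⊓ seq y n) (⊓-cauchy {seq x} {seq y} (cauchy x) (cauchy y))

abs : ℝ → ℝ
abs x = mkℝ (λ n → ∣ seq x n ∣) (abs-cauchy {seq x} (cauchy x))

_≤_ : ℝ → ℝ → Set
x ≤ y = ∀ ε → 0ℚ ℚ.< ε → ∃ λ N → ∀ n → N ℕ.≤ n → seq x n ℚ.≤ seq y n ℚ.+ ε

_<_ : ℝ → ℝ → Set
x < y = ∃ λ ε → 0ℚ ℚ.< ε × (∃ λ N → ∀ n → N ℕ.≤ n → seq x n ℚ.+ ε ℚ.≤ seq y n)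

-- A relation rather than a function: the floor of a Cauchy real is not
-- computable.  Only floors of nonnegative reals are needed.
IsFloor : ℝ → ℕ → Set
IsFloor x m = ι m ≤ x × x < ι (suc m)

record Graph (n : ℕ) : Set where
  field
    adj       : Fin n → Fin n → Bool
    symmetric : ∀ i j → adj i j ≡ adj j i
    loopless  : ∀ i → adj i i ≡ false

open Graph public

-- Each edge is listed once, as the pair (i , j) with i < j.
edges : ∀ {n} → Graph n → List (Fin n × Fin n)
edges {n} G = filterᵇ (λ (i , j) → (toℕ i ℕ.<ᵇ toℕ j) ∧ adj G i j)
                      (cartesianProduct (allFin n) (allFin n))

∣E_∣ : ∀ {n} → Graph n → ℕ
∣E G ∣ = length (edges G)

_△_ : ∀ {n} → Graph n → Graph n → Graph n
G △ G′ = record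
  { adj       = λ i j → adj G i j xor adj G′ i j
  ; symmetric = λ i j → cong₂ _xor_ (symmetric G i j) (symmetric G′ i j)
  ; loopless  = λ i → cong₂ _xor_ (loopless G i) (loopless G′ i)
  }

dist : ∀ {n} → Graph n → Graph n → ℕ
dist G G′ = ∣E G △ G′ ∣

_─_ : ∀ {n} → Graph (suc n) → Fin (suc n) → Graph n
G ─ v = record
  { adj       = λ i j → adj G (punchIn v i) (punchIn v j)
  ; symmetric = λ i j → symmetric G (punchIn v i) (punchIn v j)
  ; loopless  = λ i → loopless G (punchIn v i)
  }

record _≅_ {n} (G G′ : Graph n) : Set where
  field
    bijection : Fin n ↔ Fin n
    preserves : ∀ i j → adj G i j ≡ adj G′ (Inverse.to bijection i) (Inverse.to bijection j)

record _InducedIn_ {k n} (F : Graph k) (G : Graph n) : Set where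
  field
    embed     : Fin k → Fin n
    injective : Injective _≡_ _≡_ embed
    preserves : ∀ i j → adj F i j ≡ adj G (embed i) (embed j)

completeBipartite : (s t : ℕ) → Graph (s ℕ.+ t)
completeBipartite s t = record
  { adj       = λ i j → opposite (splitAt s i) (splitAt s j)
  ; symmetric = λ i j → opposite-comm (splitAt s i) (splitAt s j)
  ; loopless  = λ i → opposite-irrefl (splitAt s i)
  }
  where
  opposite : Fin s ⊎ Fin t → Fin s ⊎ Fin t → Bool
  opposite (inj₁ _) (inj₁ _) = false
  opposite (inj₁ _) (inj₂ _) = true
  opposite (inj₂ _) (inj₁ _) = true
  opposite (inj₂ _) (inj₂ _) = false

  opposite-comm : ∀ x y → opposite x y ≡ opposite y x
  opposite-comm (inj₁ _) (inj₁ _) = refl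
  opposite-comm (inj₁ _) (inj₂ _) = refl
  opposite-comm (inj₂ _) (inj₁ _) = refl
  opposite-comm (inj₂ _) (inj₂ _) = refl

  opposite-irrefl : ∀ x → opposite x x ≡ false
  opposite-irrefl (inj₁ _) = refl
  opposite-irrefl (inj₂ _) = refl

record HereditaryProperty : Set₁ where
  field
    Has             : ∀ {n} → Graph n → Set
    closed-iso      : ∀ {n} {G G′ : Graph n} → G ≅ G′ → Has G → Has G′
    closed-deletion : ∀ {n} {G : Graph (suc n)} v → Has G → Has (G ─ v)

open HereditaryProperty public

Forb : ∀ {k} → Graph k → HereditaryProperty
Forb F = record
  { Has             = λ G → ¬ (F InducedIn G)
  ; closed-iso      = λ iso free ind → free (pullback iso ind)
  ; closed-deletion = λ v free ind → free (undelete v ind)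
  }
  where
  open _InducedIn_

  pullback : ∀ {n} {G G′ : Graph n} → G ≅ G′ → F InducedIn G′ → F InducedIn G
  pullback {G = G} {G′} iso ind = record
    { embed     = from ∘ embed ind
    ; injective = λ {x} {y} eq → injective ind
        (trans (sym (strictlyInverseˡ (embed ind x)))
          (trans (cong to eq) (strictlyInverseˡ (embed ind y))))
    ; preserves = λ i j → trans (preserves ind i j)
        (trans (sym (cong₂ (adj G′) (strictlyInverseˡ (embed ind i))
                                    (strictlyInverseˡ (embed ind j))))
          (sym (_≅_.preserves iso (from (embed ind i)) (from (embed ind j)))))
    }
    where open Inverse (_≅_.bijection iso)

  undelete : ∀ {n} {G : Graph (suc n)} v → F InducedIn (G ─ v) → F InducedIn G
  undelete v ind = record
    { embed     = punchIn v ∘ embed ind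
    ; injective = λ eq → injective ind (punchIn-injective v _ _ eq)
    ; preserves = preserves ind
    }

IsMinimum : (ℕ → Set) → ℕ → Set
IsMinimum P d = P d × (∀ e → P e → d ℕ.≤ e)

IsMaximum : (ℕ → Set) → ℕ → Set
IsMaximum P d = P d × (∀ e → P e → e ℕ.≤ d)

-- dist(G, H) = d
IsDistTo : ∀ {n} → HereditaryProperty → Graph n → ℕ → Set
IsDistTo {n} H G = IsMinimum λ e → Σ (Graph n) λ G′ → Has H G′ × dist G G′ ≡ e

-- max { dist(G, H) : ∣V(G)∣ = n , ∣E(G)∣ = m } = d
IsMaxDist : HereditaryProperty → (n m : ℕ) → ℕ → Set
IsMaxDist H n m = IsMaximum λ e → Σ (Graph n) λ G → ∣E G ∣ ≡ m × IsDistTo H G e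

-- ed_H(p) = L, where ed_H(p) is the limit of d / C(n,2) as n → ∞.  The terms
-- of the sequence are given by relations, so the ε-N condition is imposed on
-- every value m of the floor of p C(n,2) and d of the maximum (each is unique).
-- The NonZero argument excludes only n < 2.
IsEd : HereditaryProperty → ℝ → ℝ → Set
IsEd H p L = ∀ ε → 0ℚ ℚ.< ε → ∃ λ N → ∀ n → N ℕ.≤ n →
  .{{_ : NonZero (n C 2)}} → ∀ m d →
  IsFloor (p * ι (n C 2)) m → IsMaxDist H n m d →
  abs (ι d / (n C 2) - L) < fromℚ ε

ℋ : ℕ → HereditaryProperty
ℋ t = Forb (completeBipartite 2 t)

module Submission where

-- A coloured regularity graph K recolours a graph G along a map φ from the
-- vertices of G to those of K: pairs sent to black become edges, pairs sent to
-- white become non-edges, pairs sent to grey are left alone.  If K_{2,t} does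
-- not map to K, the result has no induced K_{2,t}, and averaging over φ bounds
-- the number of changed pairs.
--
-- One white and one black vertex joined by a grey edge give p(1-p).  All other
-- bounds come from black vertices joined by grey and white edges; then K_{2,t}
-- does not map to K if and only if two distinct closed grey neighbourhoods
-- always share fewer than t vertices, and k vertices of average grey degree g
-- give (1 + (k-2-g)p)/k.
--
-- The inequality between the reals is stable under double negation, so the
-- floors, minima and maxima in the definition of the edit distance function
-- need to exist only classically.

open import Data.Bool.Base using (Bool; true; false; not; _∧_; _xor_; T)
open import Data.Bool.Properties as Bool using (T-∧)
open import Data.Fin.Base using (Fin; zero; suc; toℕ)
open import Data.Fin.Properties using (_≟_; injective⇒≤; suc-injective)
open import Data.Integer.Base as ℤ using ()
import Data.Integer.Properties as ℤ
import Data.Integer.Solver as ℤ-Solver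
open import Data.List.Base as List using (List; filterᵇ; length; cartesianProduct; foldl)
import Data.List.Properties as List
open import Data.Nat.Base as ℕ using (ℕ; zero; suc; NonZero; nonZero; z≤n; s≤s)
open import Data.Nat.Combinatorics using (_C_; nC1≡n; nCk+nC[k+1]≡[n+1]C[k+1])
open import Data.Nat.Induction using (<-rec)
import Data.Nat.Properties as ℕ
import Data.Nat.Solver as ℕ-Solver
open import Data.Product.Base using (Σ; ∃; _×_; _,_; proj₁; proj₂)
open import Data.Rational.Base as ℚ using (ℚ; 0ℚ; 1ℚ; ½; ∣_∣; toℚᵘ)
import Data.Rational.Properties as ℚ
import Data.Rational.Solver as ℚ-Solver
open import Data.Rational.Unnormalised.Base as ℚᵘ using (mkℚᵘ; *≡*; *≤*)
import Data.Rational.Unnormalised.Properties as ℚᵘ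
open import Data.Sum.Base using (inj₁; inj₂)
open import Data.Vec.Base as Vec using (Vec; lookup)
import Data.Vec.Properties as Vec
open import Function.Base using (_∘_; id)
open import Function.Bundles using (module Equivalence)
open import Function.Definitions using (Injective)
open import Relation.Binary.PropositionalEquality
open import Relation.Nullary.Decidable using (Dec; does; yes; no; dec-true; dec-false; True; toWitness)
open import Relation.Nullary.Negation.Core using (¬_; contradiction)

-- For each graph on `n` vertices the recolouring yields an inequality d / C(n,2) ≤ f (m / C(n,2))
-- without error term, where f is the line or parabola of the coloured regularity graph. The limit
-- therefore only has to absorb the rounding of the density to m / C(n,2), and for that f need only
-- be Lipschitz. A regular grey graph of degree g on k vertices satisfies g (g + 1) ≤ (t - 1)(k -
-- 1): count how often one closed neighbourhood meets the others. Equality means that the closed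
-- neighbourhoods form a symmetric design whose blocks share t - 1 points pairwise. Natural
-- candidates are thus strongly regular graphs with λ ≤ t - 3 and μ ≤ t - 1. Since only the average
-- degree and the common neighbours enter, less symmetric graphs can stand in where a strongly
-- regular one does not exist.

module Counting where

  open import Defs hiding (_+_; _-_; _*_; _/_; _⊓_; _≤_; _<_)
  open import Data.List.Base using ([]; _∷_)
  open import Data.Nat.Base using (_+_; _*_; _∸_; _≤_)
  open ℕ-Solver using (module +-*-Solver)
  open import Algebra.Properties.Semiring.Sum ℕ.+-*-semiring using
    (sum; sum-syntax; sum-cong-≗; ∑-distrib-+; ∑-comm; *-distribˡ-sum; *-distribʳ-sum; sum-replicate-zero)

  -- Edge counts as sums over pairs of vertices

  ⟦_⟧ : Bool → ℕ
  ⟦ true ⟧  = 1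
  ⟦ false ⟧ = 0

  sum-mono : ∀ {n} {f g : Fin n → ℕ} → (∀ i → f i ≤ g i) → sum f ≤ sum g
  sum-mono {zero}  f≤g = z≤n
  sum-mono {suc n} f≤g = ℕ.+-mono-≤ (f≤g zero) (sum-mono (f≤g ∘ suc))

  sum-const-1 : ∀ n → ∑[ i < n ] 1 ≡ n
  sum-const-1 zero    = refl
  sum-const-1 (suc n) = cong suc (sum-const-1 n)

  -- Runs over pairs `i < j`, with those containing `zero` split off first: the order in which
  -- `derandomise` fixes the values of φ.
  pairSum : ∀ {n} → (Fin n → Fin n → ℕ) → ℕ
  pairSum {zero}  f = 0
  pairSum {suc n} f = ∑[ j < n ] f zero (suc j) + pairSum (λ i j → f (suc i) (suc j))

  pairSum-cong : ∀ {n} {f g : Fin n → Fin n → ℕ} →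
    (∀ i j → i ≢ j → f i j ≡ g i j) → pairSum f ≡ pairSum g
  pairSum-cong {zero}  f≗g = refl
  pairSum-cong {suc n} f≗g = cong₂ _+_
    (sum-cong-≗ λ j → f≗g zero (suc j) λ ())
    (pairSum-cong λ i j i≢j → f≗g (suc i) (suc j) λ { refl → i≢j refl })

  pairSum-mono : ∀ {n} {f g : Fin n → Fin n → ℕ} →
    (∀ i j → f i j ≤ g i j) → pairSum f ≤ pairSum g
  pairSum-mono {zero}  f≤g = z≤n
  pairSum-mono {suc n} f≤g = ℕ.+-mono-≤ (sum-mono λ j → f≤g zero (suc j))
                                        (pairSum-mono λ i j → f≤g (suc i) (suc j))

  pairSum-+ : ∀ {n} (f g : Fin n → Fin n → ℕ) →
    pairSum (λ i j → f i j + g i j) ≡ pairSum f + pairSum g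
  pairSum-+ {zero}  f g = refl
  pairSum-+ {suc n} f g
    rewrite ∑-distrib-+ (f zero ∘ suc) (g zero ∘ suc)
          | pairSum-+ (λ i j → f (suc i) (suc j)) (λ i j → g (suc i) (suc j))
    = solve 4 (λ a b c d → a :+ b :+ (c :+ d) := a :+ c :+ (b :+ d)) refl
        (∑[ j < n ] f zero (suc j)) (∑[ j < n ] g zero (suc j)) _ _
    where open +-*-Solver

  pairSum-* : ∀ {n} (f : Fin n → Fin n → ℕ) c → pairSum (λ i j → f i j * c) ≡ pairSum f * c
  pairSum-* {zero}  f c = refl
  pairSum-* {suc n} f c = begin
    ∑[ j < n ] (f zero (suc j) * c) + pairSum (λ i j → f (suc i) (suc j) * c)
      ≡⟨ cong₂ _+_ (sym (*-distribʳ-sum c (f zero ∘ suc))) (pairSum-* (λ i j → f (suc i) (suc j)) c) ⟩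
    ∑[ j < n ] f zero (suc j) * c + pairSum (λ i j → f (suc i) (suc j)) * c
      ≡⟨ ℕ.*-distribʳ-+ c (∑[ j < n ] f zero (suc j)) _ ⟨
    pairSum f * c ∎
    where open ≡-Reasoning

  pairSum-1 : ∀ n → pairSum {n} (λ _ _ → 1) ≡ n C 2
  pairSum-1 zero    = refl
  pairSum-1 (suc n) = begin
    ∑[ j < n ] 1 + pairSum {n} (λ _ _ → 1) ≡⟨ cong₂ _+_ (sum-const-1 n) (pairSum-1 n) ⟩
    n + n C 2                              ≡⟨ cong (_+ n C 2) (nC1≡n n) ⟨
    n C 1 + n C 2                          ≡⟨ nCk+nC[k+1]≡[n+1]C[k+1] n 1 ⟩
    suc n C 2                              ∎
    where open ≡-Reasoning

  module _ {A : Set} (P : A → Bool) where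

    length-filterᵇ-++ : ∀ xs ys → length (filterᵇ P (xs List.++ ys)) ≡
                        length (filterᵇ P xs) + length (filterᵇ P ys)
    length-filterᵇ-++ []       ys = refl
    length-filterᵇ-++ (x ∷ xs) ys with P x
    ... | true  = cong suc (length-filterᵇ-++ xs ys)
    ... | false = length-filterᵇ-++ xs ys

    length-filterᵇ-tabulate : ∀ {n} (f : Fin n → A) →
      length (filterᵇ P (List.tabulate f)) ≡ ∑[ i < n ] ⟦ P (f i) ⟧
    length-filterᵇ-tabulate {zero}  f = refl
    length-filterᵇ-tabulate {suc n} f with P (f zero)
    ... | true  = cong suc (length-filterᵇ-tabulate (f ∘ suc))
    ... | false = length-filterᵇ-tabulate (f ∘ suc)

  length-filterᵇ-product : ∀ {A B : Set} {m n} (P : A × B → Bool) (f : Fin m → A) (g : Fin n → B) →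
    length (filterᵇ P (cartesianProduct (List.tabulate f) (List.tabulate g))) ≡
    ∑[ i < m ] ∑[ j < n ] ⟦ P (f i , g j) ⟧
  length-filterᵇ-product {m = zero}          P f g = refl
  length-filterᵇ-product {m = suc m} {n = n} P f g = begin
    length (filterᵇ P (List.map (f zero ,_) (List.tabulate g) List.++ rest))
      ≡⟨ length-filterᵇ-++ P (List.map (f zero ,_) (List.tabulate g)) rest ⟩
    length (filterᵇ P (List.map (f zero ,_) (List.tabulate g))) + length (filterᵇ P rest)
      ≡⟨ cong (λ xs → length (filterᵇ P xs) + length (filterᵇ P rest)) (List.map-tabulate g (f zero ,_)) ⟩
    length (filterᵇ P (List.tabulate (λ j → f zero , g j))) + length (filterᵇ P rest)
      ≡⟨ cong₂ _+_ (length-filterᵇ-tabulate P (λ j → f zero , g j)) (length-filterᵇ-product P (f ∘ suc) g) ⟩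
    ∑[ j < n ] ⟦ P (f zero , g j) ⟧ + ∑[ i < m ] ∑[ j < n ] ⟦ P (f (suc i) , g j) ⟧ ∎
    where
    open ≡-Reasoning
    rest = cartesianProduct (List.tabulate (f ∘ suc)) (List.tabulate g)

  ∑∑-upper : ∀ {n} (b : Fin n → Fin n → Bool) →
    ∑[ i < n ] ∑[ j < n ] ⟦ (toℕ i ℕ.<ᵇ toℕ j) ∧ b i j ⟧ ≡ pairSum (λ i j → ⟦ b i j ⟧)
  ∑∑-upper {zero}  b = refl
  ∑∑-upper {suc n} b = cong (∑[ j < n ] ⟦ b zero (suc j) ⟧ +_) (∑∑-upper (λ i j → b (suc i) (suc j)))

  ∣E∣≡pairSum : ∀ {n} (G : Graph n) → ∣E G ∣ ≡ pairSum (λ i j → ⟦ adj G i j ⟧)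
  ∣E∣≡pairSum G = trans (length-filterᵇ-product (λ (i , j) → (toℕ i ℕ.<ᵇ toℕ j) ∧ adj G i j) id id)
                        (∑∑-upper (adj G))

  ⟦b⟧≤1 : ∀ b → ⟦ b ⟧ ≤ 1
  ⟦b⟧≤1 true  = s≤s z≤n
  ⟦b⟧≤1 false = z≤n

  ∣E∣≤nC2 : ∀ {n} (G : Graph n) → ∣E G ∣ ≤ n C 2
  ∣E∣≤nC2 {n} G = begin
    ∣E G ∣                          ≡⟨ ∣E∣≡pairSum G ⟩
    pairSum (λ i j → ⟦ adj G i j ⟧) ≤⟨ pairSum-mono (λ i j → ⟦b⟧≤1 (adj G i j)) ⟩
    pairSum {n} (λ _ _ → 1)         ≡⟨ pairSum-1 n ⟩
    n C 2                           ∎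
    where open ℕ.≤-Reasoning

  ∣nonE∣ : ∀ {n} (G : Graph n) → pairSum (λ i j → ⟦ not (adj G i j) ⟧) ≡ n C 2 ∸ ∣E G ∣
  ∣nonE∣ {n} G = begin
    N                     ≡⟨ ℕ.m+n∸m≡n E N ⟨
    E + N ∸ E             ≡⟨ cong (_∸ E) (pairSum-+ {n} (λ i j → ⟦ adj G i j ⟧) _) ⟨
    pairSum (λ i j → ⟦ adj G i j ⟧ + ⟦ not (adj G i j) ⟧) ∸ E
      ≡⟨ cong (_∸ E) (trans (pairSum-cong (λ i j _ → complement (adj G i j))) (pairSum-1 n)) ⟩
    n C 2 ∸ E             ≡⟨ cong (n C 2 ∸_) (∣E∣≡pairSum G) ⟨
    n C 2 ∸ ∣E G ∣        ∎
    where
    open ≡-Reasoning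
    E = pairSum (λ i j → ⟦ adj G i j ⟧)
    N = pairSum (λ i j → ⟦ not (adj G i j) ⟧)
    complement : ∀ b → ⟦ b ⟧ + ⟦ not b ⟧ ≡ 1
    complement true  = refl
    complement false = refl

  extend : ∀ {n} → (Fin n → Bool) → Graph n → Graph (suc n)
  extend {n} s G = record { adj = a ; symmetric = a-sym ; loopless = a-irr }
    where
    a : Fin (suc n) → Fin (suc n) → Bool
    a zero    zero    = false
    a zero    (suc j) = s j
    a (suc i) zero    = s i
    a (suc i) (suc j) = adj G i j
    a-sym : ∀ i j → a i j ≡ a j i
    a-sym zero    zero    = refl
    a-sym zero    (suc j) = refl
    a-sym (suc i) zero    = refl
    a-sym (suc i) (suc j) = symmetric G i j
    a-irr : ∀ i → a i i ≡ false
    a-irr zero    = refl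
    a-irr (suc i) = loopless G i

  ∣E-extend∣ : ∀ {n} s (G : Graph n) → ∣E extend s G ∣ ≡ ∑[ j < n ] ⟦ s j ⟧ + ∣E G ∣
  ∣E-extend∣ {n} s G = trans (∣E∣≡pairSum (extend s G))
                             (cong (∑[ j < n ] ⟦ s j ⟧ +_) (sym (∣E∣≡pairSum G)))

  emptyGraph : ∀ n → Graph n
  emptyGraph n = record { adj = λ _ _ → false ; symmetric = λ _ _ → refl ; loopless = λ _ → refl }

  ∑-below : ∀ {n r} → r ≤ n → ∑[ j < n ] ⟦ toℕ j ℕ.<ᵇ r ⟧ ≡ r
  ∑-below {n}     {zero}  _         = sum-replicate-zero n
  ∑-below {suc n} {suc r} (s≤s r≤n) = cong suc (∑-below r≤n)

  -- Ensures that the maximum over graphs with `m` edges ranges over a nonempty set. The edges first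
  -- fill the graph on the other `n` vertices; only the excess over `n C 2`, at most `n`, goes to
  -- the new vertex.
  graphWithEdges : ∀ n m → m ≤ n C 2 → ∃ λ (G : Graph n) → ∣E G ∣ ≡ m
  graphWithEdges zero    m m≤0 = emptyGraph 0 , sym (ℕ.n≤0⇒n≡0 m≤0)
  graphWithEdges (suc n) m m≤ = G′ , ∣G′∣
    where
    old = (n C 2) ℕ.⊓ m
    new = m ∸ n C 2
    G   = graphWithEdges n old (ℕ.m⊓n≤m (n C 2) m)
    new≤n : new ≤ n
    new≤n = ℕ.m≤n+o⇒m∸n≤o m (n C 2) (subst (m ≤_)
      (trans (sym (nCk+nC[k+1]≡[n+1]C[k+1] n 1))
             (trans (cong (_+ n C 2) (nC1≡n n)) (ℕ.+-comm n (n C 2)))) m≤)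
    G′ = extend (λ j → toℕ j ℕ.<ᵇ new) (proj₁ G)
    ∣G′∣ : ∣E G′ ∣ ≡ m
    ∣G′∣ = begin
      ∣E G′ ∣                                               ≡⟨ ∣E-extend∣ _ (proj₁ G) ⟩
      ∑[ j < n ] ⟦ toℕ j ℕ.<ᵇ new ⟧ + ∣E proj₁ G ∣          ≡⟨ cong₂ _+_ (∑-below new≤n) (proj₂ G) ⟩
      new + old                                             ≡⟨ ℕ.+-comm new old ⟩
      old + new                                             ≡⟨ ℕ.m⊓n+n∸m≡n (n C 2) m ⟩
      m                                                     ∎
      where open ≡-Reasoning

  -- Averaging over weighted maps

  argmin : ∀ {k} (f : Fin (suc k) → ℕ) → ∃ λ a → ∀ b → f a ≤ f b
  argmin {zero}  f = zero , λ { zero → ℕ.≤-refl }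
  argmin {suc k} f with argmin (f ∘ suc)
  ... | a , a-min with ℕ.≤-total (f zero) (f (suc a))
  ...   | inj₁ 0≤a = zero , λ { zero → ℕ.≤-refl ; (suc b) → ℕ.≤-trans 0≤a (a-min b) }
  ...   | inj₂ a≤0 = suc a , λ { zero → a≤0 ; (suc b) → a-min b }

  -- `μ` is an unnormalised probability distribution: an expectation is `weigh f` over `total`.
  -- Multiplying through by `total`, once per random vertex, keeps everything in ℕ and makes sense
  -- even when `total` is zero.
  module Weighted {k} (μ : Fin (suc k) → ℕ) where

    total : ℕ
    total = sum μ

    weigh : (Fin (suc k) → ℕ) → ℕ
    weigh f = ∑[ a < suc k ] (μ a * f a)

    weigh-cong : ∀ {f g} → (∀ a → f a ≡ g a) → weigh f ≡ weigh g
    weigh-cong f≗g = sum-cong-≗ λ a → cong (μ a *_) (f≗g a)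

    weigh-+ : ∀ f g → weigh (λ a → f a + g a) ≡ weigh f + weigh g
    weigh-+ f g = trans (sum-cong-≗ λ a → ℕ.*-distribˡ-+ (μ a) (f a) (g a))
                        (∑-distrib-+ (λ a → μ a * f a) (λ a → μ a * g a))

    weigh-* : ∀ c f → weigh (λ a → c * f a) ≡ c * weigh f
    weigh-* c f = trans
      (sum-cong-≗ λ a → solve 3 (λ m c x → m :* (c :* x) := c :* (m :* x)) refl (μ a) c (f a))
      (sym (*-distribˡ-sum c (λ a → μ a * f a)))
      where open +-*-Solver

    weigh-∑ : ∀ {n} (f : Fin (suc k) → Fin n → ℕ) →
      weigh (λ a → ∑[ j < n ] f a j) ≡ ∑[ j < n ] weigh (λ a → f a j)
    weigh-∑ f = trans (sum-cong-≗ λ a → *-distribˡ-sum (μ a) (f a)) (∑-comm (λ a j → μ a * f a j))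

    below-average : ∀ f → ∃ λ a → total * f a ≤ weigh f
    below-average f with argmin f
    ... | a , a-min = a , ℕ.≤-trans (ℕ.≤-reflexive (*-distribʳ-sum (f a) μ))
                                    (sum-mono λ b → ℕ.*-monoʳ-≤ (μ b) (a-min b))

    -- The method of conditional expectations: the values φ 0, φ 1, … are chosen
    -- one after the other, and the pair costs of the chosen values are absorbed
    -- in the one-point costs u of the values still to be chosen.
    derandomise : ∀ {n} (u : Fin n → Fin (suc k) → ℕ)
      (w : Fin n → Fin n → Fin (suc k) → Fin (suc k) → ℕ) →
      ∃ λ (φ : Fin n → Fin (suc k)) →
        total * (total * pairSum (λ i j → w i j (φ i) (φ j))) + total * (total * ∑[ i < n ] u i (φ i)) ≤
        pairSum (λ i j → weigh (λ a → weigh (w i j a))) + total * ∑[ i < n ] weigh (u i)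
    derandomise {zero}  u w = (λ ()) , ℕ.≤-reflexive
      (solve 1 (λ m → m :* (m :* con 0) :+ m :* (m :* con 0) := m :* con 0) refl total)
      where open +-*-Solver
    derandomise {suc n} u w
      -- The cost expected after the choice `a`, up to a factor `total`: its own cost is certain,
      -- its pairs with later points are still averaged.
      with below-average (λ a → total * u zero a + ∑[ j < n ] weigh (w zero (suc j) a))
    ... | a , a-low
      with derandomise (λ j b → u (suc j) b + w zero (suc j) a b) (λ i j → w (suc i) (suc j))
    ... | φ , φ-low = φ′ , (begin
      M * (M * (Y + P)) + M * (M * (u zero a + X))
        ≡⟨ solve 5 (λ m y p x t → m :* (m :* (y :+ p)) :+ m :* (m :* (t :+ x))
             := (m :* (m :* p) :+ m :* (m :* (x :+ y))) :+ m :* (m :* t)) refl M Y P X (u zero a) ⟩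
      M * (M * P) + M * (M * (X + Y)) + M * (M * u zero a)
        ≡⟨ cong (λ z → M * (M * P) + M * (M * z) + M * (M * u zero a))
             (∑-distrib-+ (λ j → u (suc j) (φ j)) (λ j → w zero (suc j) a (φ j))) ⟨
      M * (M * P) + M * (M * ∑[ j < n ] (u (suc j) (φ j) + w zero (suc j) a (φ j))) + M * (M * u zero a)
        ≤⟨ ℕ.+-monoˡ-≤ (M * (M * u zero a)) φ-low ⟩
      P₂ + M * ∑[ j < n ] weigh (λ b → u (suc j) b + w zero (suc j) a b) + M * (M * u zero a)
        ≡⟨ cong (λ z → P₂ + M * z + M * (M * u zero a))
             (trans (sum-cong-≗ λ j → weigh-+ (u (suc j)) (w zero (suc j) a))
                    (∑-distrib-+ (λ j → weigh (u (suc j))) (λ j → weigh (w zero (suc j) a)))) ⟩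
      P₂ + M * (Q + R) + M * (M * u zero a)
        ≡⟨ solve 5 (λ m p q r t → p :+ m :* (q :+ r) :+ m :* (m :* t)
             := p :+ m :* q :+ m :* (m :* t :+ r)) refl M P₂ Q R (u zero a) ⟩
      P₂ + M * Q + M * (M * u zero a + R)
        ≤⟨ ℕ.+-monoʳ-≤ (P₂ + M * Q) a-low ⟩
      P₂ + M * Q + weigh (λ b → M * u zero b + ∑[ j < n ] weigh (w zero (suc j) b))
        ≡⟨ cong (P₂ + M * Q +_) (trans
             (weigh-+ (λ b → M * u zero b) (λ b → ∑[ j < n ] weigh (w zero (suc j) b)))
             (cong₂ _+_ (weigh-* M (u zero)) (weigh-∑ (λ b j → weigh (w zero (suc j) b))))) ⟩
      P₂ + M * Q + (M * weigh (u zero) + S)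
        ≡⟨ solve 5 (λ m p q e s → p :+ m :* q :+ (m :* e :+ s) := s :+ p :+ m :* (e :+ q)) refl
             M P₂ Q (weigh (u zero)) S ⟩
      S + P₂ + M * (weigh (u zero) + Q) ∎)
      where
      open +-*-Solver
      open ℕ.≤-Reasoning
      φ′ : Fin (suc n) → Fin (suc k)
      φ′ zero    = a
      φ′ (suc j) = φ j
      M  = total
      X  = ∑[ j < n ] u (suc j) (φ j)
      Y  = ∑[ j < n ] w zero (suc j) a (φ j)
      P  = pairSum (λ i j → w (suc i) (suc j) (φ i) (φ j))
      P₂ = pairSum (λ i j → weigh (λ b → weigh (w (suc i) (suc j) b)))
      Q  = ∑[ j < n ] weigh (u (suc j))
      R  = ∑[ j < n ] weigh (w zero (suc j) a)
      S  = ∑[ j < n ] weigh (λ b → weigh (w zero (suc j) b))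

module Recolouring where

  open Counting
  open import Defs hiding (_+_; _-_; _*_; _/_; _⊓_; _≤_; _<_)
  open import Data.Nat.Base using (_+_; _*_; _∸_; _≤_)
  open import Data.Nat.DivMod using (_/_; _%_)
  open import Data.Vec.Base using ([]; _∷_)
  open ℕ-Solver using (module +-*-Solver)
  open import Algebra.Properties.Semiring.Sum ℕ.+-*-semiring using
    (sum; sum-syntax; sum-cong-≗; sum-replicate-zero)

  -- Recolouring along a coloured regularity graph

  data Colour : Set where
    black white grey : Colour

  recolour : Colour → Bool → Bool
  recolour black _ = true
  recolour white _ = false
  recolour grey  b = b

  isBlack isWhite : Colour → ℕ
  isBlack black = 1
  isBlack white = 0
  isBlack grey  = 0
  isWhite black = 0
  isWhite white = 1
  isWhite grey  = 0

  does-≟-sym : ∀ {n} (i j : Fin n) → does (i ≟ j) ≡ does (j ≟ i)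
  does-≟-sym i j with i ≟ j
  ... | yes i≡j = sym (dec-true (j ≟ i) (sym i≡j))
  ... | no  i≢j = sym (dec-false (j ≟ i) (i≢j ∘ sym))

  -- A coloured regularity graph: the diagonal holds the vertex colours.
  record CRG (k : ℕ) : Set where
    field
      colour           : Fin k → Fin k → Colour
      colour-symmetric : ∀ a b → colour a b ≡ colour b a

    recoloured : ∀ {n} → Graph n → (Fin n → Fin k) → Graph n
    recoloured G φ = record
      -- Diagonal colours govern distinct vertices of one class; without the first factor a black
      -- class would create loops.
      { adj       = λ i j → not (does (i ≟ j)) ∧ recolour (colour (φ i) (φ j)) (adj G i j)
      ; symmetric = λ i j → cong₂ (λ x y → not x ∧ y) (does-≟-sym i j)
          (cong₂ recolour (colour-symmetric (φ i) (φ j)) (symmetric G i j))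
      ; loopless  = λ i → cong (λ x → not x ∧ recolour (colour (φ i) (φ i)) (adj G i i))
          (dec-true (i ≟ i) refl)
      }

    recoloured-adj : ∀ {n} (G : Graph n) φ {i j} → i ≢ j →
      adj (recoloured G φ) i j ≡ recolour (colour (φ i) (φ j)) (adj G i j)
    recoloured-adj G φ {i} {j} i≢j = cong (λ x → not x ∧ recolour (colour (φ i) (φ j)) (adj G i j))
      (dec-false (i ≟ j) i≢j)

    -- No map from K_{2,t}, injective or not, is compatible with the colours.
    Avoids-K₂ : ℕ → Set
    Avoids-K₂ t = ∀ x y (z : Fin t → Fin k) →
      colour x y ≢ black → (∀ i j → i ≢ j → colour (z i) (z j) ≢ black) →
      (∀ i → colour x (z i) ≢ white) → ¬ (∀ i → colour y (z i) ≢ white)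

    -- An induced copy followed by φ would be a map excluded by `Avoids-K₂`: after recolouring a
    -- black pair is always an edge and a white pair never.
    recoloured-Has : ∀ {t n} → Avoids-K₂ t → (G : Graph n) (φ : Fin n → Fin k) →
      Has (ℋ t) (recoloured G φ)
    recoloured-Has {t} avoids G φ ind = avoids (ψ zero) (ψ (suc zero)) (λ i → ψ (suc (suc i)))
      (nonadjacent (λ ()) refl)
      (λ i j i≢j → nonadjacent (λ { refl → i≢j refl }) refl)
      (λ i → adjacent (λ ()) refl)
      (λ i → adjacent (λ ()) refl)
      where
      open _InducedIn_ ind
      ψ : Fin (2 + t) → Fin k
      ψ u = φ (embed u)
      edge : ∀ {u v} → u ≢ v → adj (completeBipartite 2 t) u v ≡
             recolour (colour (ψ u) (ψ v)) (adj G (embed u) (embed v))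
      edge u≢v = trans (preserves _ _) (recoloured-adj G φ (u≢v ∘ injective))
      nonadjacent : ∀ {u v} → u ≢ v → adj (completeBipartite 2 t) u v ≡ false →
                    colour (ψ u) (ψ v) ≢ black
      nonadjacent u≢v uv is-black with trans (sym uv) (trans (edge u≢v) (cong (λ x → recolour x _) is-black))
      ... | ()
      adjacent : ∀ {u v} → u ≢ v → adj (completeBipartite 2 t) u v ≡ true →
                 colour (ψ u) (ψ v) ≢ white
      adjacent u≢v uv is-white with trans (sym uv) (trans (edge u≢v) (cong (λ x → recolour x _) is-white))
      ... | ()

  module _ {k} (K : CRG (suc k)) (μ : Fin (suc k) → ℕ) where
    open CRG K
    open Weighted μ

    blackWeight whiteWeight : ℕ
    blackWeight = weigh λ a → weigh λ b → isBlack (colour a b)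
    whiteWeight = weigh λ a → weigh λ b → isWhite (colour a b)

    -- For a random φ an edge is deleted exactly when its ends receive a white pair, and a non-edge
    -- is filled exactly when they receive a black one, so the expected cost of a pair depends only
    -- on its adjacency.
    dist-recoloured : ∀ {n} (G : Graph n) → ∃ λ φ →
      total * (total * dist G (recoloured G φ)) ≤
      ∣E G ∣ * whiteWeight + (n C 2 ∸ ∣E G ∣) * blackWeight
    dist-recoloured {n} G
      with derandomise (λ (i : Fin n) _ → 0) (λ i j a b → ⟦ adj G i j xor recolour (colour a b) (adj G i j) ⟧)
    ... | φ , φ-low = φ , (begin
      total * (total * dist G (recoloured G φ))
        ≡⟨ cong (λ d → total * (total * d)) (trans (∣E∣≡pairSum (G △ recoloured G φ))
             (pairSum-cong λ i j i≢j → cong (λ x → ⟦ adj G i j xor x ⟧) (recoloured-adj G φ i≢j))) ⟩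
      total * (total * pairSum (λ i j → w i j (φ i) (φ j)))
        ≤⟨ ℕ.m≤m+n _ _ ⟩
      total * (total * pairSum (λ i j → w i j (φ i) (φ j))) + total * (total * ∑[ i < n ] 0)
        ≤⟨ φ-low ⟩
      pairSum (λ i j → weigh (λ a → weigh (w i j a))) + total * ∑[ i < n ] weigh (λ _ → 0)
        ≡⟨ cong₂ _+_ (pairSum-cong λ i j _ → expected (adj G i j))
             (trans (cong (total *_) (trans (sum-cong-≗ {n} λ _ → weigh-0) (sum-replicate-zero n)))
                    (ℕ.*-zeroʳ total)) ⟩
      pairSum (λ i j → ⟦ adj G i j ⟧ * whiteWeight + ⟦ not (adj G i j) ⟧ * blackWeight) + 0
        ≡⟨ trans (ℕ.+-identityʳ _) (pairSum-+ (λ i j → ⟦ adj G i j ⟧ * whiteWeight) _) ⟩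
      pairSum (λ i j → ⟦ adj G i j ⟧ * whiteWeight) + pairSum (λ i j → ⟦ not (adj G i j) ⟧ * blackWeight)
        ≡⟨ cong₂ _+_ (pairSum-* (λ i j → ⟦ adj G i j ⟧) whiteWeight)
                     (pairSum-* (λ i j → ⟦ not (adj G i j) ⟧) blackWeight) ⟩
      pairSum (λ i j → ⟦ adj G i j ⟧) * whiteWeight + pairSum (λ i j → ⟦ not (adj G i j) ⟧) * blackWeight
        ≡⟨ cong₂ (λ x y → x * whiteWeight + y * blackWeight) (sym (∣E∣≡pairSum G)) (∣nonE∣ G) ⟩
      ∣E G ∣ * whiteWeight + (n C 2 ∸ ∣E G ∣) * blackWeight ∎)
      where
      open ℕ.≤-Reasoning
      w : Fin n → Fin n → Fin (suc k) → Fin (suc k) → ℕ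
      w i j a b = ⟦ adj G i j xor recolour (colour a b) (adj G i j) ⟧
      weigh-0 : weigh (λ _ → 0) ≡ 0
      weigh-0 = trans (sum-cong-≗ λ a → ℕ.*-zeroʳ (μ a)) (sum-replicate-zero (suc k))
      flip-edge : ∀ x → ⟦ true xor recolour x true ⟧ ≡ isWhite x
      flip-edge black = refl
      flip-edge white = refl
      flip-edge grey  = refl
      flip-nonedge : ∀ x → ⟦ false xor recolour x false ⟧ ≡ isBlack x
      flip-nonedge black = refl
      flip-nonedge white = refl
      flip-nonedge grey  = refl
      expected : ∀ e → weigh (λ a → weigh (λ b → ⟦ e xor recolour (colour a b) e ⟧)) ≡
                 ⟦ e ⟧ * whiteWeight + ⟦ not e ⟧ * blackWeight
      expected true  = trans (weigh-cong λ a → weigh-cong λ b → flip-edge (colour a b))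
        (sym (trans (ℕ.+-identityʳ (whiteWeight + 0)) (ℕ.+-identityʳ whiteWeight)))
      expected false = trans (weigh-cong λ a → weigh-cong λ b → flip-nonedge (colour a b))
        (sym (ℕ.+-identityʳ blackWeight))

  -- The split graph behind p(1-p)

  split : CRG 2
  split = record { colour = c ; colour-symmetric = c-sym }
    where
    c : Fin 2 → Fin 2 → Colour
    c zero       zero       = white
    c zero       (suc zero) = grey
    c (suc zero) zero       = grey
    c (suc zero) (suc zero) = black
    c-sym : ∀ a b → c a b ≡ c b a
    c-sym zero       zero       = refl
    c-sym zero       (suc zero) = refl
    c-sym (suc zero) zero       = refl
    c-sym (suc zero) (suc zero) = refl

  -- Split graphs have no induced 4-cycle. One of the nonadjacent `x`, `y` is in the white part, so
  -- all its neighbours are in the black part, where `z zero` and `z (suc zero)` would be adjacent.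
  split-avoids : ∀ t → CRG.Avoids-K₂ split (2 + t)
  split-avoids t x y z xy zz xz yz with x | y | z zero | z (suc zero) | xy | zz zero (suc zero) (λ ())
    | xz zero | xz (suc zero) | yz zero | yz (suc zero)
  ... | zero     | _        | suc zero | suc zero | _   | ¬b | _  | _  | _  | _  = ¬b refl
  ... | zero     | _        | zero     | _        | _   | _  | ¬w | _  | _  | _  = ¬w refl
  ... | zero     | _        | suc zero | zero     | _   | _  | _  | ¬w | _  | _  = ¬w refl
  ... | suc zero | zero     | suc zero | suc zero | _   | ¬b | _  | _  | _  | _  = ¬b refl
  ... | suc zero | zero     | zero     | _        | _   | _  | _  | _  | ¬w | _  = ¬w refl
  ... | suc zero | zero     | suc zero | zero     | _   | _  | _  | _  | _  | ¬w = ¬w refl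
  ... | suc zero | suc zero | _        | _        | ¬b′ | _  | _  | _  | _  | _  = ¬b′ refl

  -- Grey graphs as Boolean matrices

  zeros : ∀ {n} → Vec Bool n → ℕ
  zeros v = Vec.sum (Vec.map (⟦_⟧ ∘ not) v)

  ∑-lookup : ∀ {A : Set} {n} (f : A → ℕ) (v : Vec A n) →
    ∑[ i < n ] f (lookup v i) ≡ Vec.sum (Vec.map f v)
  ∑-lookup f []      = refl
  ∑-lookup f (x ∷ v) = cong (f x +_) (∑-lookup f v)

  common : ∀ {n} → Vec Bool n → Vec Bool n → ℕ
  common []          []          = 0
  common (true  ∷ u) (true  ∷ v) = suc (common u v)
  common (true  ∷ u) (false ∷ v) = common u v
  common (false ∷ u) (_     ∷ v) = common u v

  -- The position of `i` among the common members; it turns distinct common members into distinct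
  -- elements of `Fin (common u v)`.
  rank : ∀ {n} (u v : Vec Bool n) i → lookup u i ≡ true → lookup v i ≡ true → Fin (common u v)
  rank (true  ∷ u) (true  ∷ v) zero    _ _ = zero
  rank (true  ∷ u) (true  ∷ v) (suc i) p q = suc (rank u v i p q)
  rank (true  ∷ u) (false ∷ v) (suc i) p q = rank u v i p q
  rank (false ∷ u) (_     ∷ v) (suc i) p q = rank u v i p q

  rank-injective : ∀ {n} (u v : Vec Bool n) {i j} p q p′ q′ →
    rank u v i p q ≡ rank u v j p′ q′ → i ≡ j
  rank-injective (true  ∷ u) (true  ∷ v) {zero}  {zero}  _ _ _  _  _  = refl
  rank-injective (true  ∷ u) (true  ∷ v) {suc i} {suc j} p q p′ q′ eq =
    cong suc (rank-injective u v p q p′ q′ (suc-injective eq))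
  rank-injective (true  ∷ u) (false ∷ v) {suc i} {suc j} p q p′ q′ eq =
    cong suc (rank-injective u v p q p′ q′ eq)
  rank-injective (false ∷ u) (_     ∷ v) {suc i} {suc j} p q p′ q′ eq =
    cong suc (rank-injective u v p q p′ q′ eq)

  injective⇒≤common : ∀ {t n} (u v : Vec Bool n) (z : Fin t → Fin n) → Injective _≡_ _≡_ z →
    (∀ i → lookup u (z i) ≡ true) → (∀ i → lookup v (z i) ≡ true) → t ≤ common u v
  injective⇒≤common u v z z-inj uz vz = injective⇒≤ {f = λ i → rank u v (z i) (uz i) (vz i)}
    λ eq → z-inj (rank-injective u v (uz _) (vz _) (uz _) (vz _) eq)

  common-comm : ∀ {n} (u v : Vec Bool n) → common u v ≡ common v u
  common-comm []          []          = refl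
  common-comm (true  ∷ u) (true  ∷ v) = cong suc (common-comm u v)
  common-comm (true  ∷ u) (false ∷ v) = common-comm u v
  common-comm (false ∷ u) (true  ∷ v) = common-comm u v
  common-comm (false ∷ u) (false ∷ v) = common-comm u v

  against : ∀ {m n} → ℕ → Vec Bool n → Vec (Vec Bool n) m → Bool
  against s u []      = true
  against s u (v ∷ M) = (common u v ℕ.≤ᵇ s) ∧ against s u M

  -- A Boolean that compares each pair of rows once, so that `sparse` is settled by evaluation.
  pairwise : ∀ {m n} → ℕ → Vec (Vec Bool n) m → Bool
  pairwise s []      = true
  pairwise s (v ∷ M) = against s v M ∧ pairwise s M

  against⇒ : ∀ {m n} s (u : Vec Bool n) (M : Vec (Vec Bool n) m) → T (against s u M) →
    ∀ i → common u (lookup M i) ≤ s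
  against⇒ s u (v ∷ M) ok zero    = ℕ.≤ᵇ⇒≤ (common u v) s (proj₁ (Equivalence.to T-∧ ok))
  against⇒ s u (v ∷ M) ok (suc i) =
    against⇒ s u M (proj₂ (Equivalence.to (T-∧ {common u v ℕ.≤ᵇ s}) ok)) i

  pairwise⇒ : ∀ {m n} s (M : Vec (Vec Bool n) m) → T (pairwise s M) →
    ∀ i j → i ≢ j → common (lookup M i) (lookup M j) ≤ s
  pairwise⇒ s (v ∷ M) ok zero    zero    i≢j = contradiction refl i≢j
  pairwise⇒ s (v ∷ M) ok zero    (suc j) i≢j = against⇒ s v M (proj₁ (Equivalence.to T-∧ ok)) j
  pairwise⇒ s (v ∷ M) ok (suc i) zero    i≢j = subst (_≤ s) (common-comm v (lookup M i))
    (against⇒ s v M (proj₁ (Equivalence.to T-∧ ok)) i)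
  pairwise⇒ s (v ∷ M) ok (suc i) (suc j) i≢j =
    pairwise⇒ s M (proj₂ (Equivalence.to (T-∧ {against s v M}) ok)) i j λ { refl → i≢j refl }

  lookup-transpose : ∀ {A : Set} {m n} (M : Vec (Vec A n) m) i j →
    lookup (lookup (Vec.transpose M) j) i ≡ lookup (lookup M i) j
  lookup-transpose {n = n} (v ∷ M) i j = trans (cong (λ u → lookup u i) column) (at i)
    where
    column : lookup (Vec.transpose (v ∷ M)) j ≡ lookup v j ∷ lookup (Vec.transpose M) j
    column = trans (Vec.lookup-⊛ j (Vec.replicate n _∷_ Vec.⊛ v) (Vec.transpose M))
      (cong (λ f → f (lookup (Vec.transpose M) j))
        (trans (Vec.lookup-⊛ j (Vec.replicate n _∷_) v)
               (cong (λ f → f (lookup v j)) (Vec.lookup-replicate j _∷_))))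
    at : ∀ i → lookup (lookup v j ∷ lookup (Vec.transpose M) j) i ≡ lookup (lookup (v ∷ M) i) j
    at zero    = refl
    at (suc i) = lookup-transpose M i j

  -- Row `a` is the closed grey neighbourhood of `a`, hence `true` on the diagonal although the
  -- vertices are black. Here `s` is t - 1, and `w` is the average number of white edges at a
  -- vertex, that is k - 1 - g. The types of `selfdual` and `sparse` evaluate to the unit type for a
  -- concrete matrix, so the instances fill them by `_`.
  record GreyMatrix (k s w : ℕ) : Set where
    field
      matrix    : Vec (Vec Bool k) k
      selfdual  : True (Vec.≡-dec (Vec.≡-dec Bool._≟_) (Vec.transpose matrix) matrix)
      reflexive : Vec.tabulate (λ a → lookup (lookup matrix a) a) ≡ Vec.replicate k true
      sparse    : T (pairwise s matrix)
      whites    : Vec.sum (Vec.map zeros matrix) ≡ k * w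

    entry : Fin k → Fin k → Bool
    entry a b = lookup (lookup matrix a) b

    entry-symmetric : ∀ a b → entry a b ≡ entry b a
    entry-symmetric a b = trans (sym (lookup-transpose matrix a b))
                                (cong (λ M → lookup (lookup M b) a) (toWitness selfdual))

    entry-reflexive : ∀ a → entry a a ≡ true
    entry-reflexive a = begin
      entry a a                                    ≡⟨ Vec.lookup∘tabulate (λ a → entry a a) a ⟨
      lookup (Vec.tabulate (λ a → entry a a)) a    ≡⟨ cong (λ v → lookup v a) reflexive ⟩
      lookup (Vec.replicate k true) a              ≡⟨ Vec.lookup-replicate a true ⟩
      true                                         ∎
      where open ≡-Reasoning

    shade : Bool → Bool → Colour
    shade true  _     = black
    shade false true  = grey
    shade false false = white

    crg : CRG k
    crg = record
      { colour           = λ a b → shade (does (a ≟ b)) (entry a b)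
      ; colour-symmetric = λ a b → cong₂ shade (does-≟-sym a b) (entry-symmetric a b)
      }

    open CRG crg

    not-black : ∀ {a b} → colour a b ≢ black → a ≢ b
    not-black {a} {b} ¬b refl rewrite dec-true (a ≟ a) refl = ¬b refl

    not-white : ∀ {a b} → colour a b ≢ white → entry a b ≡ true
    not-white {a} {b} ¬w with a ≟ b
    ... | yes refl = entry-reflexive a
    ... | no _ with entry a b
    ...   | true  = refl
    ...   | false = contradiction refl ¬w

    -- As all vertices are black, nonadjacent vertices have distinct images: `x` differs from `y`,
    -- and `z` is injective. Every `z i` lies in both closed grey neighbourhoods, which share at
    -- most `s` vertices.
    avoids : Avoids-K₂ (suc s)
    avoids x y z xy zz xz yz = ℕ.<⇒≱ (s≤s (pairwise⇒ s matrix sparse x y (not-black xy)))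
      (injective⇒≤common (lookup matrix x) (lookup matrix y) z z-injective
        (λ i → not-white (xz i)) (λ i → not-white (yz i)))
      where
      z-injective : Injective _≡_ _≡_ z
      z-injective {i} {j} eq with i ≟ j
      ... | yes i≡j = i≡j
      ... | no  i≢j = contradiction eq (not-black (zz i j i≢j))

  ∑-diagonal : ∀ {k} (a : Fin k) → ∑[ b < k ] ⟦ does (a ≟ b) ⟧ ≡ 1
  ∑-diagonal {suc k} zero    = cong suc (sum-replicate-zero k)
  ∑-diagonal {suc k} (suc a) = ∑-diagonal a

  module _ {k s w} (M : GreyMatrix (suc k) s w) where
    open GreyMatrix M
    open CRG crg
    open Weighted {k} (λ _ → 1)

    weigh-1 : ∀ f → weigh f ≡ sum f
    weigh-1 f = sum-cong-≗ λ a → ℕ.*-identityˡ (f a)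

    weigh₂-1 : ∀ (f : Fin (suc k) → Fin (suc k) → ℕ) →
      weigh (λ a → weigh (f a)) ≡ ∑[ a < suc k ] ∑[ b < suc k ] f a b
    weigh₂-1 f = trans (weigh-1 λ a → weigh (f a)) (sum-cong-≗ λ a → weigh-1 (f a))

    blackWeight-crg : blackWeight crg (λ _ → 1) ≡ suc k
    blackWeight-crg = trans (weigh₂-1 λ a b → isBlack (colour a b)) (trans
      (sum-cong-≗ λ a → trans (sum-cong-≗ λ b → shade-black (does (a ≟ b)) (entry a b)) (∑-diagonal a))
      (sum-const-1 (suc k)))
      where
      shade-black : ∀ x y → isBlack (shade x y) ≡ ⟦ x ⟧
      shade-black true  _     = refl
      shade-black false true  = refl
      shade-black false false = refl

    whiteWeight-crg : whiteWeight crg (λ _ → 1) ≤ suc k * w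
    whiteWeight-crg = begin
      whiteWeight crg (λ _ → 1)                            ≡⟨ weigh₂-1 (λ a b → isWhite (colour a b)) ⟩
      ∑[ a < suc k ] ∑[ b < suc k ] isWhite (colour a b)
        ≤⟨ sum-mono (λ a → sum-mono λ b → shade-white (does (a ≟ b)) (entry a b)) ⟩
      ∑[ a < suc k ] ∑[ b < suc k ] ⟦ not (entry a b) ⟧
        ≡⟨ sum-cong-≗ (λ a → ∑-lookup (⟦_⟧ ∘ not) (lookup matrix a)) ⟩
      ∑[ a < suc k ] zeros (lookup matrix a)               ≡⟨ ∑-lookup zeros matrix ⟩
      Vec.sum (Vec.map zeros matrix)                       ≡⟨ whites ⟩
      suc k * w                                            ∎
      where
      open ℕ.≤-Reasoning
      shade-white : ∀ x y → isWhite (shade x y) ≤ ⟦ not y ⟧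
      shade-white true  _     = z≤n
      shade-white false true  = z≤n
      shade-white false false = s≤s z≤n

    -- Under uniform weights just the `suc k` diagonal pairs are black and at most `suc k * w`
    -- ordered pairs are white, so one of the two factors `suc k` cancels.
    matrix-dist : ∀ {n} (G : Graph n) → ∃ λ G′ → Has (ℋ (suc s)) G′ ×
      suc k * dist G G′ ≤ ∣E G ∣ * w + (n C 2 ∸ ∣E G ∣)
    matrix-dist {n} G with dist-recoloured crg (λ _ → 1) G
    ... | φ , φ-low = recoloured G φ , recoloured-Has avoids G φ , ℕ.*-cancelˡ-≤ (suc k) (begin
      suc k * (suc k * dist G (recoloured G φ))
        ≡⟨ cong (λ m → m * (m * dist G (recoloured G φ))) (sum-const-1 (suc k)) ⟨
      total * (total * dist G (recoloured G φ))
        ≤⟨ φ-low ⟩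
      ∣E G ∣ * whiteWeight crg (λ _ → 1) + (n C 2 ∸ ∣E G ∣) * blackWeight crg (λ _ → 1)
        ≤⟨ ℕ.+-mono-≤ (ℕ.*-monoʳ-≤ ∣E G ∣ whiteWeight-crg)
                      (ℕ.≤-reflexive (cong ((n C 2 ∸ ∣E G ∣) *_) blackWeight-crg)) ⟩
      ∣E G ∣ * (suc k * w) + (n C 2 ∸ ∣E G ∣) * suc k
        ≡⟨ solve 4 (λ e k w c → e :* (k :* w) :+ c :* k := k :* (e :* w :+ c)) refl
             ∣E G ∣ (suc k) w (n C 2 ∸ ∣E G ∣) ⟩
      suc k * (∣E G ∣ * w + (n C 2 ∸ ∣E G ∣)) ∎)
      where
      open ℕ.≤-Reasoning
      open +-*-Solver

  -- Weighting the two parts by the numbers of edges and of non-edges of G.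
  split-dist : ∀ {n} t (G : Graph n) → ∃ λ G′ → Has (ℋ (2 + t)) G′ ×
    (n C 2) * ((n C 2) * dist G G′) ≤ ∣E G ∣ * (n C 2 ∸ ∣E G ∣) * (n C 2)
  split-dist {n} t G with dist-recoloured split (lookup ((n C 2 ∸ ∣E G ∣) ∷ ∣E G ∣ ∷ [])) G
  ... | φ , φ-low = recoloured G φ , recoloured-Has (split-avoids t) G φ ,
    subst₂ (λ M r → M * (M * dist G (recoloured G φ)) ≤ r) sum≡ weight≡ φ-low
    where
    open CRG split
    open +-*-Solver
    m = ∣E G ∣
    r = n C 2 ∸ ∣E G ∣
    m+r≡ : m + r ≡ n C 2
    m+r≡ = ℕ.m+[n∸m]≡n (∣E∣≤nC2 G)
    sum≡ : r + (m + 0) ≡ n C 2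
    sum≡ = trans (solve 2 (λ m r → r :+ (m :+ con 0) := m :+ r) refl m r) m+r≡
    -- The two weights of `split` after unfolding, with `r` on the white vertex and `m` on the black
    -- one; the sum is m r² + r m².
    weight≡ : m * (r * (r * 1 + (m * 0 + 0)) + (m * (r * 0 + (m * 0 + 0)) + 0)) +
              r * (r * (r * 0 + (m * 0 + 0)) + (m * (r * 0 + (m * 1 + 0)) + 0)) ≡ m * r * (n C 2)
    weight≡ = trans (solve 2 (λ m r →
        m :* (r :* (r :* con 1 :+ (m :* con 0 :+ con 0)) :+ (m :* (r :* con 0 :+ (m :* con 0 :+ con 0)) :+ con 0)) :+
        r :* (r :* (r :* con 0 :+ (m :* con 0 :+ con 0)) :+ (m :* (r :* con 0 :+ (m :* con 1 :+ con 0)) :+ con 0))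
        := m :* r :* (m :+ r)) refl m r)
      (cong (m * r *_) m+r≡)

  -- The concrete grey graphs

  bits : ∀ d → ℕ → Vec Bool d
  bits zero    n = []
  bits (suc d) n = (n % 2 ℕ.≡ᵇ 1) ∷ bits d (n / 2)

  rotate : ∀ {A : Set} {n} → Vec A n → Vec A n
  rotate {n = zero}  [] = []
  rotate {n = suc n} v  = Vec.last v ∷ Vec.init v

  -- Bit y − x (mod d) of the (a , b) entry of the table is the entry of the
  -- matrix in row a d + x and column b d + y.
  blockCirculant : ∀ {m} d → Vec (Vec ℕ m) m → Vec (Vec Bool (m * d)) (m * d)
  blockCirculant d table = Vec.concat (Vec.map
    (λ row → Vec.map Vec.concat (Vec.iterate (Vec.map rotate) (Vec.map (bits d) row) d)) table)

  -- The matrices of order 40, 85 and 156 are the collinearity relations of the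
  -- symplectic generalised quadrangles over F₃, F₄ and F₅, those of order 64 and
  -- 125 come from their Payne derivatives, that of order 96 is a symmetric
  -- (96,20,4) design of McFarland type, and that of order 25 is a Paley graph.
  -- The others were found by computer search.
  matrix₁₃ : Vec (Vec Bool 13) 13
  matrix₁₃ = blockCirculant 13
    ( (5659 ∷ [])
    ∷ [])

  grey₁₃ : GreyMatrix 13 4 6
  grey₁₃ = record
    { matrix = matrix₁₃ ; selfdual = _ ; reflexive = refl ; sparse = _ ; whites = refl }

  -- The octahedron: 55 lacks only bit 3, so the white edges form a perfect matching.
  matrix₆ : Vec (Vec Bool 6) 6
  matrix₆ = blockCirculant 6
    ( (55 ∷ [])
    ∷ [])

  grey₆ : GreyMatrix 6 4 1
  grey₆ = record
    { matrix = matrix₆ ; selfdual = _ ; reflexive = refl ; sparse = _ ; whites = refl }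

  matrix₄₀ : Vec (Vec Bool 40) 40
  matrix₄₀ = blockCirculant 10
    ( (169 ∷  16 ∷ 774 ∷ 226 ∷ [])
    ∷ ( 64 ∷ 113 ∷ 586 ∷  27 ∷ [])
    ∷ (774 ∷ 658 ∷ 547 ∷   2 ∷ [])
    ∷ (568 ∷ 705 ∷ 512 ∷ 293 ∷ [])
    ∷ [])

  grey₄₀ : GreyMatrix 40 4 27
  grey₄₀ = record
    { matrix = matrix₄₀ ; selfdual = _ ; reflexive = refl ; sparse = _ ; whites = refl }

  matrix₉₆ : Vec (Vec Bool 96) 96
  matrix₉₆ = blockCirculant 12
    ( ( 225 ∷ 2064 ∷    0 ∷ 1026 ∷ 1093 ∷  132 ∷   54 ∷ 2052 ∷ [])
    ∷ ( 258 ∷  337 ∷ 2304 ∷ 1440 ∷ 3072 ∷   99 ∷  144 ∷    0 ∷ [])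
    ∷ (   0 ∷   18 ∷  225 ∷ 3072 ∷ 1314 ∷ 2304 ∷  337 ∷  384 ∷ [])
    ∷ (2052 ∷  180 ∷    6 ∷ 1093 ∷ 1152 ∷    0 ∷ 2064 ∷   99 ∷ [])
    ∷ (1093 ∷    6 ∷ 2196 ∷   36 ∷ 2115 ∷   48 ∷    0 ∷ 1152 ∷ [])
    ∷ (1056 ∷ 2241 ∷   18 ∷    0 ∷  384 ∷  337 ∷  288 ∷ 3330 ∷ [])
    ∷ (3456 ∷  288 ∷  337 ∷  258 ∷    0 ∷  144 ∷ 2115 ∷ 1056 ∷ [])
    ∷ (1026 ∷    0 ∷   48 ∷ 2241 ∷   36 ∷ 2070 ∷  132 ∷ 1093 ∷ [])
    ∷ [])

  grey₉₆ : GreyMatrix 96 4 76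
  grey₉₆ = record
    { matrix = matrix₉₆ ; selfdual = _ ; reflexive = refl ; sparse = _ ; whites = refl }

  -- The white edges form the Petersen graph: pentagons of step 2 and step 1 in the two blocks, and
  -- a perfect matching between them.
  matrix₁₀ : Vec (Vec Bool 10) 10
  matrix₁₀ = blockCirculant 5
    ( (19 ∷ 27 ∷ [])
    ∷ (23 ∷ 13 ∷ [])
    ∷ [])

  grey₁₀ : GreyMatrix 10 5 3
  grey₁₀ = record
    { matrix = matrix₁₀ ; selfdual = _ ; reflexive = refl ; sparse = _ ; whites = refl }

  -- Again a Paley graph, here given by the non-squares modulo 17.
  matrix₁₇ : Vec (Vec Bool 17) 17
  matrix₁₇ = blockCirculant 17
    ( (23785 ∷ [])
    ∷ [])

  grey₁₇ : GreyMatrix 17 5 8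
  grey₁₇ = record
    { matrix = matrix₁₇ ; selfdual = _ ; reflexive = refl ; sparse = _ ; whites = refl }

  matrix₂₆ : Vec (Vec Bool 26) 26
  matrix₂₆ = blockCirculant 13
    ( (5659 ∷  282 ∷ [])
    ∷ (5664 ∷ 2533 ∷ [])
    ∷ [])

  grey₂₆ : GreyMatrix 26 5 15
  grey₂₆ = record
    { matrix = matrix₂₆ ; selfdual = _ ; reflexive = refl ; sparse = _ ; whites = refl }

  matrix₈₅ : Vec (Vec Bool 85) 85
  matrix₈₅ = blockCirculant 17
    ( (10321 ∷ 19588 ∷  2048 ∷ 45059 ∷ 36976 ∷ [])
    ∷ (33992 ∷ 49165 ∷ 41512 ∷ 28744 ∷     8 ∷ [])
    ∷ (   64 ∷ 20756 ∷ 66691 ∷ 78352 ∷ 27392 ∷ [])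
    ∷ (65589 ∷ 18488 ∷  8498 ∷     1 ∷ 10378 ∷ [])
    ∷ (14372 ∷ 16384 ∷   856 ∷ 83024 ∷  4897 ∷ [])
    ∷ [])

  grey₈₅ : GreyMatrix 85 5 64
  grey₈₅ = record
    { matrix = matrix₈₅ ; selfdual = _ ; reflexive = refl ; sparse = _ ; whites = refl }

  -- The white edges form a perfect matching: 239 lacks only bit 4.
  matrix₈ : Vec (Vec Bool 8) 8
  matrix₈ = blockCirculant 8
    ( (239 ∷ [])
    ∷ [])

  grey₈ : GreyMatrix 8 6 1
  grey₈ = record
    { matrix = matrix₈ ; selfdual = _ ; reflexive = refl ; sparse = _ ; whites = refl }

  -- Closed neighbourhoods have 10 members and share at most 6. As 10 · 9 = 6 · 15, they share
  -- exactly 6, and the grey graph is strongly regular with parameters (16,9,4,6).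
  matrix₁₆ : Vec (Vec Bool 16) 16
  matrix₁₆ = blockCirculant 8
    ( (147 ∷ 175 ∷ [])
    ∷ (235 ∷  57 ∷ [])
    ∷ [])

  grey₁₆ : GreyMatrix 16 6 6
  grey₁₆ = record
    { matrix = matrix₁₆ ; selfdual = _ ; reflexive = refl ; sparse = _ ; whites = refl }

  -- At most 6 common members are in particular at most 7, so the graph serves t = 8 as well.
  grey₁₆′ : GreyMatrix 16 7 6
  grey₁₆′ = record
    { matrix = matrix₁₆ ; selfdual = _ ; reflexive = refl ; sparse = _ ; whites = refl }

  -- As 15 · 14 = 6 · 35, the same count makes this strongly regular with parameters (36,14,4,6).
  matrix₃₆ : Vec (Vec Bool 36) 36
  matrix₃₆ = blockCirculant 12
    ( (3143 ∷ 2716 ∷ 2084 ∷ [])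
    ∷ (1834 ∷  521 ∷ 2296 ∷ [])
    ∷ (1154 ∷  994 ∷ 1253 ∷ [])
    ∷ [])

  grey₃₆ : GreyMatrix 36 6 21
  grey₃₆ = record
    { matrix = matrix₃₆ ; selfdual = _ ; reflexive = refl ; sparse = _ ; whites = refl }

  grey₃₆′ : GreyMatrix 36 7 21
  grey₃₆′ = record
    { matrix = matrix₃₆ ; selfdual = _ ; reflexive = refl ; sparse = _ ; whites = refl }

  -- Supplies the line (1 + 30x)/48, which is mixed with that of `matrix₆₄` to reach denominator 49.
  matrix₄₈ : Vec (Vec Bool 48) 48
  matrix₄₈ = blockCirculant 12
    ( (2051 ∷ 1337 ∷ 1680 ∷ 1200 ∷ [])
    ∷ ( 917 ∷ 2051 ∷ 2820 ∷ 1680 ∷ [])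
    ∷ ( 300 ∷ 1050 ∷  497 ∷ 2576 ∷ [])
    ∷ ( 420 ∷  300 ∷  266 ∷  497 ∷ [])
    ∷ [])

  grey₄₈ : GreyMatrix 48 6 31
  grey₄₈ = record
    { matrix = matrix₄₈ ; selfdual = _ ; reflexive = refl ; sparse = _ ; whites = refl }

  matrix₆₄ : Vec (Vec Bool 64) 64
  matrix₆₄ = blockCirculant 8
    ( ( 41 ∷ 197 ∷  17 ∷   3 ∷  65 ∷  48 ∷ 142 ∷   0 ∷ [])
    ∷ ( 71 ∷   1 ∷ 129 ∷  57 ∷  36 ∷   0 ∷  65 ∷ 154 ∷ [])
    ∷ ( 17 ∷   3 ∷  41 ∷ 197 ∷   0 ∷ 142 ∷  48 ∷  65 ∷ [])
    ∷ (129 ∷  57 ∷  71 ∷   1 ∷ 154 ∷  65 ∷   0 ∷  36 ∷ [])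
    ∷ (  5 ∷  72 ∷   0 ∷ 178 ∷ 131 ∷  77 ∷  33 ∷  17 ∷ [])
    ∷ ( 24 ∷   0 ∷ 226 ∷   5 ∷ 101 ∷   1 ∷ 147 ∷   9 ∷ [])
    ∷ (226 ∷   5 ∷  24 ∷   0 ∷   9 ∷ 147 ∷   1 ∷ 101 ∷ [])
    ∷ (  0 ∷ 178 ∷   5 ∷  72 ∷  17 ∷  33 ∷  77 ∷ 131 ∷ [])
    ∷ [])

  grey₆₄ : GreyMatrix 64 6 45
  grey₆₄ = record
    { matrix = matrix₆₄ ; selfdual = _ ; reflexive = refl ; sparse = _ ; whites = refl }

  matrix₁₀₀ : Vec (Vec Bool 100) 100
  matrix₁₀₀ = blockCirculant 5
    ( ( 1 ∷  0 ∷  1 ∷  1 ∷  0 ∷  0 ∷  6 ∷ 21 ∷  1 ∷  0 ∷ 18 ∷  1 ∷ 16 ∷ 16 ∷ 14 ∷  0 ∷  2 ∷  9 ∷  0 ∷ 19 ∷ [])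
    ∷ ( 0 ∷  1 ∷  0 ∷  1 ∷  1 ∷  0 ∷  0 ∷  6 ∷ 21 ∷  1 ∷ 14 ∷ 18 ∷  1 ∷ 16 ∷ 16 ∷ 19 ∷  0 ∷  2 ∷  9 ∷  0 ∷ [])
    ∷ ( 1 ∷  0 ∷  1 ∷  0 ∷  1 ∷  1 ∷  0 ∷  0 ∷  6 ∷ 21 ∷ 16 ∷ 14 ∷ 18 ∷  1 ∷ 16 ∷  0 ∷ 19 ∷  0 ∷  2 ∷  9 ∷ [])
    ∷ ( 1 ∷  1 ∷  0 ∷  1 ∷  0 ∷ 21 ∷  1 ∷  0 ∷  0 ∷  6 ∷ 16 ∷ 16 ∷ 14 ∷ 18 ∷  1 ∷  9 ∷  0 ∷ 19 ∷  0 ∷  2 ∷ [])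
    ∷ ( 0 ∷  1 ∷  1 ∷  0 ∷  1 ∷  6 ∷ 21 ∷  1 ∷  0 ∷  0 ∷  1 ∷ 16 ∷ 16 ∷ 14 ∷ 18 ∷  2 ∷  9 ∷  0 ∷ 19 ∷  0 ∷ [])
    ∷ ( 0 ∷  0 ∷  1 ∷ 11 ∷ 24 ∷  1 ∷  2 ∷  0 ∷  0 ∷ 16 ∷  0 ∷  2 ∷  9 ∷  0 ∷ 19 ∷ 12 ∷  8 ∷  4 ∷ 22 ∷  2 ∷ [])
    ∷ (24 ∷  0 ∷  0 ∷  1 ∷ 11 ∷ 16 ∷  1 ∷  2 ∷  0 ∷  0 ∷ 19 ∷  0 ∷  2 ∷  9 ∷  0 ∷  2 ∷ 12 ∷  8 ∷  4 ∷ 22 ∷ [])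
    ∷ (11 ∷ 24 ∷  0 ∷  0 ∷  1 ∷  0 ∷ 16 ∷  1 ∷  2 ∷  0 ∷  0 ∷ 19 ∷  0 ∷  2 ∷  9 ∷ 22 ∷  2 ∷ 12 ∷  8 ∷  4 ∷ [])
    ∷ ( 1 ∷ 11 ∷ 24 ∷  0 ∷  0 ∷  0 ∷  0 ∷ 16 ∷  1 ∷  2 ∷  9 ∷  0 ∷ 19 ∷  0 ∷  2 ∷  4 ∷ 22 ∷  2 ∷ 12 ∷  8 ∷ [])
    ∷ ( 0 ∷  1 ∷ 11 ∷ 24 ∷  0 ∷  2 ∷  0 ∷  0 ∷ 16 ∷  1 ∷  2 ∷  9 ∷  0 ∷ 19 ∷  0 ∷  8 ∷  4 ∷ 22 ∷  2 ∷ 12 ∷ [])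
    ∷ (18 ∷ 28 ∷  2 ∷  2 ∷  1 ∷  0 ∷ 19 ∷  0 ∷  5 ∷ 16 ∷  1 ∷  0 ∷  1 ∷  1 ∷  0 ∷  0 ∷  0 ∷  1 ∷ 11 ∷ 24 ∷ [])
    ∷ ( 1 ∷ 18 ∷ 28 ∷  2 ∷  2 ∷ 16 ∷  0 ∷ 19 ∷  0 ∷  5 ∷  0 ∷  1 ∷  0 ∷  1 ∷  1 ∷ 24 ∷  0 ∷  0 ∷  1 ∷ 11 ∷ [])
    ∷ ( 2 ∷  1 ∷ 18 ∷ 28 ∷  2 ∷  5 ∷ 16 ∷  0 ∷ 19 ∷  0 ∷  1 ∷  0 ∷  1 ∷  0 ∷  1 ∷ 11 ∷ 24 ∷  0 ∷  0 ∷  1 ∷ [])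
    ∷ ( 2 ∷  2 ∷  1 ∷ 18 ∷ 28 ∷  0 ∷  5 ∷ 16 ∷  0 ∷ 19 ∷  1 ∷  1 ∷  0 ∷  1 ∷  0 ∷  1 ∷ 11 ∷ 24 ∷  0 ∷  0 ∷ [])
    ∷ (28 ∷  2 ∷  2 ∷  1 ∷ 18 ∷ 19 ∷  0 ∷  5 ∷ 16 ∷  0 ∷  0 ∷  1 ∷  1 ∷  0 ∷  1 ∷  0 ∷  1 ∷ 11 ∷ 24 ∷  0 ∷ [])
    ∷ ( 0 ∷ 19 ∷  0 ∷  5 ∷ 16 ∷ 12 ∷ 16 ∷ 26 ∷  8 ∷  4 ∷  0 ∷  6 ∷ 21 ∷  1 ∷  0 ∷  1 ∷  2 ∷  0 ∷  0 ∷ 16 ∷ [])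
    ∷ (16 ∷  0 ∷ 19 ∷  0 ∷  5 ∷  4 ∷ 12 ∷ 16 ∷ 26 ∷  8 ∷  0 ∷  0 ∷  6 ∷ 21 ∷  1 ∷ 16 ∷  1 ∷  2 ∷  0 ∷  0 ∷ [])
    ∷ ( 5 ∷ 16 ∷  0 ∷ 19 ∷  0 ∷  8 ∷  4 ∷ 12 ∷ 16 ∷ 26 ∷  1 ∷  0 ∷  0 ∷  6 ∷ 21 ∷  0 ∷ 16 ∷  1 ∷  2 ∷  0 ∷ [])
    ∷ ( 0 ∷  5 ∷ 16 ∷  0 ∷ 19 ∷ 26 ∷  8 ∷  4 ∷ 12 ∷ 16 ∷ 21 ∷  1 ∷  0 ∷  0 ∷  6 ∷  0 ∷  0 ∷ 16 ∷  1 ∷  2 ∷ [])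
    ∷ (19 ∷  0 ∷  5 ∷ 16 ∷  0 ∷ 16 ∷ 26 ∷  8 ∷  4 ∷ 12 ∷  6 ∷ 21 ∷  1 ∷  0 ∷  0 ∷  2 ∷  0 ∷  0 ∷ 16 ∷  1 ∷ [])
    ∷ [])

  grey₁₀₀ : GreyMatrix 100 6 77
  grey₁₀₀ = record
    { matrix = matrix₁₀₀ ; selfdual = _ ; reflexive = refl ; sparse = _ ; whites = refl }

  matrix₁₅₆ : Vec (Vec Bool 156) 156
  matrix₁₅₆ = blockCirculant 26
    ( (17309829 ∷        8 ∷  3413504 ∷ 37783570 ∷ 51384337 ∷  1650696 ∷ [])
    ∷ ( 8388608 ∷ 12591129 ∷ 42209346 ∷  8424992 ∷ 34275334 ∷ 37783570 ∷ [])
    ∷ (  213344 ∷ 34619658 ∷   291073 ∷ 16828800 ∷ 35670592 ∷    16384 ∷ [])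
    ∷ (37783570 ∷  2328584 ∷   825348 ∷  1091649 ∷ 33554432 ∷ 25166657 ∷ [])
    ∷ ( 4210759 ∷ 50333314 ∷  1216546 ∷        2 ∷   206337 ∷  8521812 ∷ [])
    ∷ ( 8414400 ∷ 37783570 ∷     4096 ∷  1441805 ∷ 22053384 ∷ 35659811 ∷ [])
    ∷ [])

  grey₁₅₆ : GreyMatrix 156 6 125
  grey₁₅₆ = record
    { matrix = matrix₁₅₆ ; selfdual = _ ; reflexive = refl ; sparse = _ ; whites = refl }

  grey₁₅₆′ : GreyMatrix 156 7 125
  grey₁₅₆′ = record
    { matrix = matrix₁₅₆ ; selfdual = _ ; reflexive = refl ; sparse = _ ; whites = refl }

  matrix₁₃′ : Vec (Vec Bool 13) 13
  matrix₁₃′ = blockCirculant 13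
    ( (2041 ∷ [])
    ∷ [])

  grey₁₃′ : GreyMatrix 13 7 4
  grey₁₃′ = record
    { matrix = matrix₁₃′ ; selfdual = _ ; reflexive = refl ; sparse = _ ; whites = refl }

  matrix₂₅ : Vec (Vec Bool 25) 25
  matrix₂₅ = blockCirculant 5
    ( ( 1 ∷ 28 ∷ 26 ∷ 22 ∷ 14 ∷ [])
    ∷ (14 ∷  1 ∷ 28 ∷ 26 ∷ 22 ∷ [])
    ∷ (22 ∷ 14 ∷  1 ∷ 28 ∷ 26 ∷ [])
    ∷ (26 ∷ 22 ∷ 14 ∷  1 ∷ 28 ∷ [])
    ∷ (28 ∷ 26 ∷ 22 ∷ 14 ∷  1 ∷ [])
    ∷ [])

  grey₂₅ : GreyMatrix 25 7 12
  grey₂₅ = record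
    { matrix = matrix₂₅ ; selfdual = _ ; reflexive = refl ; sparse = _ ; whites = refl }

  -- Supplies the line (1 + 31x)/51, which is mixed with that of `matrix₁₂₅` to reach denominator
  -- 76.
  matrix₅₁ : Vec (Vec Bool 51) 51
  matrix₅₁ = blockCirculant 17
    ( (23785 ∷ 49488 ∷  2504 ∷ [])
    ∷ (10764 ∷ 73747 ∷ 47570 ∷ [])
    ∷ (20032 ∷ 77428 ∷ 33541 ∷ [])
    ∷ [])

  grey₅₁ : GreyMatrix 51 7 32
  grey₅₁ = record
    { matrix = matrix₅₁ ; selfdual = _ ; reflexive = refl ; sparse = _ ; whites = refl }

  matrix₁₂₅ : Vec (Vec Bool 125) 125
  matrix₁₂₅ = blockCirculant 5
    ( (31 ∷  1 ∷  1 ∷  1 ∷  1 ∷  1 ∷ 16 ∷  8 ∷  4 ∷  2 ∷  1 ∷ 16 ∷  8 ∷  4 ∷  2 ∷  1 ∷ 16 ∷  8 ∷  4 ∷  2 ∷  1 ∷ 16 ∷  8 ∷  4 ∷  2 ∷ [])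
    ∷ ( 1 ∷ 31 ∷  1 ∷  1 ∷  1 ∷  2 ∷  1 ∷ 16 ∷  8 ∷  4 ∷  4 ∷  2 ∷  1 ∷ 16 ∷  8 ∷  8 ∷  4 ∷  2 ∷  1 ∷ 16 ∷ 16 ∷  8 ∷  4 ∷  2 ∷  1 ∷ [])
    ∷ ( 1 ∷  1 ∷ 31 ∷  1 ∷  1 ∷  4 ∷  2 ∷  1 ∷ 16 ∷  8 ∷ 16 ∷  8 ∷  4 ∷  2 ∷  1 ∷  2 ∷  1 ∷ 16 ∷  8 ∷  4 ∷  8 ∷  4 ∷  2 ∷  1 ∷ 16 ∷ [])
    ∷ ( 1 ∷  1 ∷  1 ∷ 31 ∷  1 ∷  8 ∷  4 ∷  2 ∷  1 ∷ 16 ∷  2 ∷  1 ∷ 16 ∷  8 ∷  4 ∷ 16 ∷  8 ∷  4 ∷  2 ∷  1 ∷  4 ∷  2 ∷  1 ∷ 16 ∷  8 ∷ [])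
    ∷ ( 1 ∷  1 ∷  1 ∷  1 ∷ 31 ∷ 16 ∷  8 ∷  4 ∷  2 ∷  1 ∷  8 ∷  4 ∷  2 ∷  1 ∷ 16 ∷  4 ∷  2 ∷  1 ∷ 16 ∷  8 ∷  2 ∷  1 ∷ 16 ∷  8 ∷  4 ∷ [])
    ∷ ( 1 ∷ 16 ∷  8 ∷  4 ∷  2 ∷  1 ∷  5 ∷ 17 ∷  3 ∷  9 ∷  1 ∷  8 ∷  2 ∷ 16 ∷  4 ∷  1 ∷  2 ∷  4 ∷  8 ∷ 16 ∷ 31 ∷  0 ∷  0 ∷  0 ∷  0 ∷ [])
    ∷ ( 2 ∷  1 ∷ 16 ∷  8 ∷  4 ∷  9 ∷  1 ∷  5 ∷ 17 ∷  3 ∷ 16 ∷  4 ∷  1 ∷  8 ∷  2 ∷  4 ∷  8 ∷ 16 ∷  1 ∷  2 ∷  0 ∷  0 ∷  0 ∷  0 ∷ 31 ∷ [])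
    ∷ ( 4 ∷  2 ∷  1 ∷ 16 ∷  8 ∷  3 ∷  9 ∷  1 ∷  5 ∷ 17 ∷  8 ∷  2 ∷ 16 ∷  4 ∷  1 ∷ 16 ∷  1 ∷  2 ∷  4 ∷  8 ∷  0 ∷  0 ∷  0 ∷ 31 ∷  0 ∷ [])
    ∷ ( 8 ∷  4 ∷  2 ∷  1 ∷ 16 ∷ 17 ∷  3 ∷  9 ∷  1 ∷  5 ∷  4 ∷  1 ∷  8 ∷  2 ∷ 16 ∷  2 ∷  4 ∷  8 ∷ 16 ∷  1 ∷  0 ∷  0 ∷ 31 ∷  0 ∷  0 ∷ [])
    ∷ (16 ∷  8 ∷  4 ∷  2 ∷  1 ∷  5 ∷ 17 ∷  3 ∷  9 ∷  1 ∷  2 ∷ 16 ∷  4 ∷  1 ∷  8 ∷  8 ∷ 16 ∷  1 ∷  2 ∷  4 ∷  0 ∷ 31 ∷  0 ∷  0 ∷  0 ∷ [])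
    ∷ ( 1 ∷  8 ∷  2 ∷ 16 ∷  4 ∷  1 ∷  2 ∷  4 ∷  8 ∷ 16 ∷  1 ∷  5 ∷ 17 ∷  3 ∷  9 ∷ 31 ∷  0 ∷  0 ∷  0 ∷  0 ∷  1 ∷  8 ∷  2 ∷ 16 ∷  4 ∷ [])
    ∷ ( 2 ∷ 16 ∷  4 ∷  1 ∷  8 ∷  4 ∷  8 ∷ 16 ∷  1 ∷  2 ∷  9 ∷  1 ∷  5 ∷ 17 ∷  3 ∷  0 ∷  0 ∷  0 ∷  0 ∷ 31 ∷ 16 ∷  4 ∷  1 ∷  8 ∷  2 ∷ [])
    ∷ ( 4 ∷  1 ∷  8 ∷  2 ∷ 16 ∷ 16 ∷  1 ∷  2 ∷  4 ∷  8 ∷  3 ∷  9 ∷  1 ∷  5 ∷ 17 ∷  0 ∷  0 ∷  0 ∷ 31 ∷  0 ∷  8 ∷  2 ∷ 16 ∷  4 ∷  1 ∷ [])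
    ∷ ( 8 ∷  2 ∷ 16 ∷  4 ∷  1 ∷  2 ∷  4 ∷  8 ∷ 16 ∷  1 ∷ 17 ∷  3 ∷  9 ∷  1 ∷  5 ∷  0 ∷  0 ∷ 31 ∷  0 ∷  0 ∷  4 ∷  1 ∷  8 ∷  2 ∷ 16 ∷ [])
    ∷ (16 ∷  4 ∷  1 ∷  8 ∷  2 ∷  8 ∷ 16 ∷  1 ∷  2 ∷  4 ∷  5 ∷ 17 ∷  3 ∷  9 ∷  1 ∷  0 ∷ 31 ∷  0 ∷  0 ∷  0 ∷  2 ∷ 16 ∷  4 ∷  1 ∷  8 ∷ [])
    ∷ ( 1 ∷  4 ∷ 16 ∷  2 ∷  8 ∷  1 ∷  8 ∷  2 ∷ 16 ∷  4 ∷ 31 ∷  0 ∷  0 ∷  0 ∷  0 ∷  1 ∷  5 ∷ 17 ∷  3 ∷  9 ∷  1 ∷  2 ∷  4 ∷  8 ∷ 16 ∷ [])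
    ∷ ( 2 ∷  8 ∷  1 ∷  4 ∷ 16 ∷ 16 ∷  4 ∷  1 ∷  8 ∷  2 ∷  0 ∷  0 ∷  0 ∷  0 ∷ 31 ∷  9 ∷  1 ∷  5 ∷ 17 ∷  3 ∷  4 ∷  8 ∷ 16 ∷  1 ∷  2 ∷ [])
    ∷ ( 4 ∷ 16 ∷  2 ∷  8 ∷  1 ∷  8 ∷  2 ∷ 16 ∷  4 ∷  1 ∷  0 ∷  0 ∷  0 ∷ 31 ∷  0 ∷  3 ∷  9 ∷  1 ∷  5 ∷ 17 ∷ 16 ∷  1 ∷  2 ∷  4 ∷  8 ∷ [])
    ∷ ( 8 ∷  1 ∷  4 ∷ 16 ∷  2 ∷  4 ∷  1 ∷  8 ∷  2 ∷ 16 ∷  0 ∷  0 ∷ 31 ∷  0 ∷  0 ∷ 17 ∷  3 ∷  9 ∷  1 ∷  5 ∷  2 ∷  4 ∷  8 ∷ 16 ∷  1 ∷ [])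
    ∷ (16 ∷  2 ∷  8 ∷  1 ∷  4 ∷  2 ∷ 16 ∷  4 ∷  1 ∷  8 ∷  0 ∷ 31 ∷  0 ∷  0 ∷  0 ∷  5 ∷ 17 ∷  3 ∷  9 ∷  1 ∷  8 ∷ 16 ∷  1 ∷  2 ∷  4 ∷ [])
    ∷ ( 1 ∷  2 ∷  4 ∷  8 ∷ 16 ∷ 31 ∷  0 ∷  0 ∷  0 ∷  0 ∷  1 ∷  2 ∷  4 ∷  8 ∷ 16 ∷  1 ∷  8 ∷  2 ∷ 16 ∷  4 ∷  1 ∷  5 ∷ 17 ∷  3 ∷  9 ∷ [])
    ∷ ( 2 ∷  4 ∷  8 ∷ 16 ∷  1 ∷  0 ∷  0 ∷  0 ∷  0 ∷ 31 ∷  4 ∷  8 ∷ 16 ∷  1 ∷  2 ∷ 16 ∷  4 ∷  1 ∷  8 ∷  2 ∷  9 ∷  1 ∷  5 ∷ 17 ∷  3 ∷ [])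
    ∷ ( 4 ∷  8 ∷ 16 ∷  1 ∷  2 ∷  0 ∷  0 ∷  0 ∷ 31 ∷  0 ∷ 16 ∷  1 ∷  2 ∷  4 ∷  8 ∷  8 ∷  2 ∷ 16 ∷  4 ∷  1 ∷  3 ∷  9 ∷  1 ∷  5 ∷ 17 ∷ [])
    ∷ ( 8 ∷ 16 ∷  1 ∷  2 ∷  4 ∷  0 ∷  0 ∷ 31 ∷  0 ∷  0 ∷  2 ∷  4 ∷  8 ∷ 16 ∷  1 ∷  4 ∷  1 ∷  8 ∷  2 ∷ 16 ∷ 17 ∷  3 ∷  9 ∷  1 ∷  5 ∷ [])
    ∷ (16 ∷  1 ∷  2 ∷  4 ∷  8 ∷  0 ∷ 31 ∷  0 ∷  0 ∷  0 ∷  8 ∷ 16 ∷  1 ∷  2 ∷  4 ∷  2 ∷ 16 ∷  4 ∷  1 ∷  8 ∷  5 ∷ 17 ∷  3 ∷  9 ∷  1 ∷ [])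
    ∷ [])

  grey₁₂₅ : GreyMatrix 125 7 96
  grey₁₂₅ = record
    { matrix = matrix₁₂₅ ; selfdual = _ ; reflexive = refl ; sparse = _ ; whites = refl }

  -- All edges are grey on t - 1 vertices: every closed neighbourhood is the whole vertex set, which
  -- is as large as allowed.
  complete₄ : GreyMatrix 4 4 0
  complete₄ = record
    { matrix = Vec.replicate 4 (Vec.replicate 4 true)
    ; selfdual = _ ; reflexive = refl ; sparse = _ ; whites = refl }

  complete₅ : GreyMatrix 5 5 0
  complete₅ = record
    { matrix = Vec.replicate 5 (Vec.replicate 5 true)
    ; selfdual = _ ; reflexive = refl ; sparse = _ ; whites = refl }

  complete₆ : GreyMatrix 6 6 0
  complete₆ = record
    { matrix = Vec.replicate 6 (Vec.replicate 6 true)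
    ; selfdual = _ ; reflexive = refl ; sparse = _ ; whites = refl }

  complete₇ : GreyMatrix 7 7 0
  complete₇ = record
    { matrix = Vec.replicate 7 (Vec.replicate 7 true)
    ; selfdual = _ ; reflexive = refl ; sparse = _ ; whites = refl }

module EditDistance where

  open Counting
  open Recolouring
  open import Defs hiding (_+_; _-_; _*_; _/_; _⊓_; _≤_; _<_)
  import Defs as ℝ
  open import Data.Rational.Base using (_+_; _-_; _*_; -_; _≤_; _<_)
  open ℚ-Solver using (module +-*-Solver)

  -- Rational arithmetic and the order of the reals

  fromℕ : ℕ → ℚ
  fromℕ n = ℤ.+ n ℚ./ 1

  -- `fromℕ` and `1/ℕ_` are the terms inside `ι` and the division of reals, so that
  -- `f (seq p i) ≡ seq b i` is mostly `refl`.
  1/ℕ_ : (d : ℕ) → .{{NonZero d}} → ℚ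
  1/ℕ d = ℤ.+ 1 ℚ./ d

  private
    toℚᵘ-fromℕ : ∀ n → toℚᵘ (fromℕ n) ℚᵘ.≃ mkℚᵘ (ℤ.+ n) 0
    toℚᵘ-fromℕ n = ℚ.toℚᵘ-fromℚᵘ (mkℚᵘ (ℤ.+ n) 0)

  fromℕ-+ : ∀ m n → fromℕ (m ℕ.+ n) ≡ fromℕ m + fromℕ n
  fromℕ-+ m n = ℚ.toℚᵘ-injective (begin-equality
    toℚᵘ (fromℕ (m ℕ.+ n))                ≃⟨ toℚᵘ-fromℕ (m ℕ.+ n) ⟩
    mkℚᵘ (ℤ.+ (m ℕ.+ n)) 0                  ≃⟨ *≡* (solve 2 (λ a b →
                                                (a :+ b) :* con (ℤ.+ 1) := (a :* con (ℤ.+ 1) :+ b :* con (ℤ.+ 1)) :* con (ℤ.+ 1))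
                                                refl (ℤ.+ m) (ℤ.+ n)) ⟩
    mkℚᵘ (ℤ.+ m) 0 ℚᵘ.+ mkℚᵘ (ℤ.+ n) 0        ≃⟨ ℚᵘ.+-cong (toℚᵘ-fromℕ m) (toℚᵘ-fromℕ n) ⟨
    toℚᵘ (fromℕ m) ℚᵘ.+ toℚᵘ (fromℕ n)    ≃⟨ ℚ.toℚᵘ-homo-+ (fromℕ m) (fromℕ n) ⟨
    toℚᵘ (fromℕ m + fromℕ n)              ∎)
    where
    open ℚᵘ.≤-Reasoning
    open ℤ-Solver.+-*-Solver

  fromℕ-* : ∀ m n → fromℕ (m ℕ.* n) ≡ fromℕ m * fromℕ n
  fromℕ-* m n = ℚ.toℚᵘ-injective (begin-equality
    toℚᵘ (fromℕ (m ℕ.* n))                ≃⟨ toℚᵘ-fromℕ (m ℕ.* n) ⟩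
    mkℚᵘ (ℤ.+ (m ℕ.* n)) 0                  ≃⟨ *≡* (cong (ℤ._* ℤ.+ 1) (ℤ.pos-* m n)) ⟩
    mkℚᵘ (ℤ.+ m) 0 ℚᵘ.* mkℚᵘ (ℤ.+ n) 0        ≃⟨ ℚᵘ.*-cong (toℚᵘ-fromℕ m) (toℚᵘ-fromℕ n) ⟨
    toℚᵘ (fromℕ m) ℚᵘ.* toℚᵘ (fromℕ n)    ≃⟨ ℚ.toℚᵘ-homo-* (fromℕ m) (fromℕ n) ⟨
    toℚᵘ (fromℕ m * fromℕ n)              ∎)
    where open ℚᵘ.≤-Reasoning

  fromℕ-mono : ∀ {m n} → m ℕ.≤ n → fromℕ m ≤ fromℕ n
  fromℕ-mono {m} {n} m≤n = ℚ.toℚᵘ-cancel-≤ (begin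
    toℚᵘ (fromℕ m) ≃⟨ toℚᵘ-fromℕ m ⟩
    mkℚᵘ (ℤ.+ m) 0   ≤⟨ *≤* (ℤ.*-monoʳ-≤-nonNeg (ℤ.+ 1) (ℤ.+≤+ m≤n)) ⟩
    mkℚᵘ (ℤ.+ n) 0   ≃⟨ toℚᵘ-fromℕ n ⟨
    toℚᵘ (fromℕ n) ∎)
    where open ℚᵘ.≤-Reasoning

  fromℕ-1/ : ∀ d .{{_ : NonZero d}} → fromℕ d * 1/ℕ d ≡ 1ℚ
  fromℕ-1/ (suc d) = ℚ.toℚᵘ-injective (begin-equality
    toℚᵘ (fromℕ (suc d) * 1/ℕ (suc d))             ≃⟨ ℚ.toℚᵘ-homo-* (fromℕ (suc d)) (1/ℕ (suc d)) ⟩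
    toℚᵘ (fromℕ (suc d)) ℚᵘ.* toℚᵘ (1/ℕ (suc d))   ≃⟨ ℚᵘ.*-cong (toℚᵘ-fromℕ (suc d)) (ℚ.toℚᵘ-fromℚᵘ (mkℚᵘ (ℤ.+ 1) d)) ⟩
    mkℚᵘ (ℤ.+ suc d) 0 ℚᵘ.* mkℚᵘ (ℤ.+ 1) d             ≃⟨ *≡* (solve 1 (λ a →
                                                        (a :* con (ℤ.+ 1)) :* con (ℤ.+ 1) := con (ℤ.+ 1) :* (con (ℤ.+ 1) :* a))
                                                        refl (ℤ.+ suc d)) ⟩
    mkℚᵘ (ℤ.+ 1) 0                                   ∎)
    where
    open ℚᵘ.≤-Reasoning
    open ℤ-Solver.+-*-Solver

  0≤fromℕ : ∀ n → 0ℚ ≤ fromℕ n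
  0≤fromℕ n = fromℕ-mono {0} {n} z≤n

  0<1/ℕ : ∀ d .{{_ : NonZero d}} → 0ℚ < 1/ℕ d
  0<1/ℕ d = ℚ.positive⁻¹ (1/ℕ d) {{ℚ.normalize-pos 1 d}}

  0≤1/ℕ : ∀ d .{{_ : NonZero d}} → 0ℚ ≤ 1/ℕ d
  0≤1/ℕ d = ℚ.<⇒≤ (0<1/ℕ d)

  archimedean : ∀ q → ∃ λ K → q ≤ fromℕ K
  archimedean q = K , ℚ.toℚᵘ-cancel-≤ (begin
    toℚᵘ q           ≤⟨ below q ⟩
    mkℚᵘ (ℤ.+ ℤ.∣ ℚ.↥ q ∣) 0  ≃⟨ toℚᵘ-fromℕ K ⟨
    toℚᵘ (fromℕ K)   ∎)
    where
    open ℚᵘ.≤-Reasoning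
    K = ℤ.∣ ℚ.↥ q ∣
    below : ∀ q → toℚᵘ q ℚᵘ.≤ mkℚᵘ (ℤ.+ ℤ.∣ ℚ.↥ q ∣) 0
    below (ℚ.mkℚ (ℤ.+ n) d _) = *≤* (ℤ.*-monoˡ-≤-nonNeg (ℤ.+ n) (ℤ.+≤+ (s≤s z≤n)))
    below (ℚ.mkℚ (ℤ.-[1+ n ]) d _) = *≤* ℤ.-≤+

  -- Linear and quadratic inequalities are proved by exhibiting the difference of
  -- the two sides as a combination of nonnegative terms.
  ≤-diff : ∀ {p q} r → 0ℚ ≤ r → q ≡ p + r → p ≤ q
  ≤-diff {p} {q} r 0≤r q≡p+r = subst₂ _≤_ (ℚ.+-identityʳ p) (sym q≡p+r) (ℚ.+-monoʳ-≤ p 0≤r)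

  diff-≥0 : ∀ {p q} → p ≤ q → 0ℚ ≤ q - p
  diff-≥0 {p} {q} p≤q = subst (_≤ q - p) (ℚ.+-inverseʳ p) (ℚ.+-monoˡ-≤ (- p) p≤q)

  +-≥0 : ∀ {p q} → 0ℚ ≤ p → 0ℚ ≤ q → 0ℚ ≤ p + q
  +-≥0 {p} {q} 0≤p 0≤q = ℚ.+-mono-≤ 0≤p 0≤q

  *-≥0 : ∀ {p q} → 0ℚ ≤ p → 0ℚ ≤ q → 0ℚ ≤ p * q
  *-≥0 {p} {q} 0≤p 0≤q = ℚ.nonNegative⁻¹ (p * q)
    {{ℚ.nonNeg*nonNeg⇒nonNeg p {{ℚ.nonNegative 0≤p}} q {{ℚ.nonNegative 0≤q}}}}

  *->0 : ∀ {p q} → 0ℚ < p → 0ℚ < q → 0ℚ < p * q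
  *->0 {p} {q} 0<p 0<q = subst (_< p * q) (ℚ.*-zeroʳ p) (ℚ.*-monoʳ-<-pos p {{ℚ.positive 0<p}} 0<q)

  p≤∣p∣ : ∀ p → p ≤ ∣ p ∣
  p≤∣p∣ p with ℚ.≤-total 0ℚ p
  ... | inj₁ 0≤p = ℚ.≤-reflexive (sym (ℚ.0≤p⇒∣p∣≡p 0≤p))
  ... | inj₂ p≤0 = ℚ.≤-trans p≤0 (ℚ.nonNegative⁻¹ ∣ p ∣ {{ℚ.∣-∣-nonNeg p}})

  module _ where
    open +-*-Solver

    ∣p-q∣<ε⇒p≤q+ε : ∀ p q {ε} → ∣ p - q ∣ < ε → p ≤ q + ε
    ∣p-q∣<ε⇒p≤q+ε p q {ε} lt = ≤-diff (ε - (p - q)) (diff-≥0 (ℚ.≤-trans (p≤∣p∣ (p - q)) (ℚ.<⇒≤ lt)))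
      (solve 3 (λ p q e → q :+ e := p :+ (e :- (p :- q))) refl p q ε)

    ∣p-q∣≤ε⇒q≤p+ε : ∀ p q {ε} → ∣ p - q ∣ ≤ ε → q ≤ p + ε
    ∣p-q∣≤ε⇒q≤p+ε p q {ε} le = ≤-diff (ε - (- (p - q)))
      (diff-≥0 (ℚ.≤-trans (p≤∣p∣ (- (p - q))) (subst (_≤ ε) (sym (ℚ.∣-p∣≡∣p∣ (p - q))) le)))
      (solve 3 (λ p q e → p :+ e := q :+ (e :- (:- (p :- q)))) refl p q ε)

    halves : ∀ ε → ε ≡ ½ * ε + ½ * ε
    halves ε = trans (sym (ℚ.*-identityˡ ε)) (ℚ.*-distribʳ-+ ε ½ ½)

    -- Compare the two sequences far out, where both have settled.
    ≮⇒≤ : ∀ {x y} → ¬ (y ℝ.< x) → x ℝ.≤ y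
    ≮⇒≤ {x} {y} y≮x ε 0<ε = go (cauchy x δ 0<δ) (cauchy y δ 0<δ)
      where
      -- An eighth of ε. The values at `N` are compared with threshold 3δ, and moving to another
      -- index costs δ on each side: this leaves x ≤ y + 5δ in one case and a gap of δ in the other.
      δ = ½ * (½ * (½ * ε))
      0<δ : 0ℚ < δ
      0<δ = *->0 (ℚ.positive⁻¹ ½) (*->0 (ℚ.positive⁻¹ ½) (*->0 (ℚ.positive⁻¹ ½) 0<ε))
      0≤δ : 0ℚ ≤ δ
      0≤δ = ℚ.<⇒≤ 0<δ
      ε≡8δ : ε ≡ δ + δ + (δ + δ) + (δ + δ + (δ + δ))
      ε≡8δ = solve 1 (λ e → let d = con ½ :* (con ½ :* (con ½ :* e)) in
        e := d :+ d :+ (d :+ d) :+ (d :+ d :+ (d :+ d))) refl ε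
      go : (∃ λ N → ∀ m n → N ℕ.≤ m → N ℕ.≤ n → ∣ seq x m - seq x n ∣ < δ) →
           (∃ λ N → ∀ m n → N ℕ.≤ m → N ℕ.≤ n → ∣ seq y m - seq y n ∣ < δ) →
           ∃ λ N → ∀ n → N ℕ.≤ n → seq x n ≤ seq y n + ε
      go (N₁ , hx) (N₂ , hy) = compare (seq x N ℚ.≤? seq y N + (δ + δ + δ))
        where
        N = N₁ ℕ.⊔ N₂
        N₁≤ : ∀ {n} → N ℕ.≤ n → N₁ ℕ.≤ n
        N₁≤ = ℕ.m⊔n≤o⇒m≤o N₁ N₂
        N₂≤ : ∀ {n} → N ℕ.≤ n → N₂ ℕ.≤ n
        N₂≤ = ℕ.m⊔n≤o⇒n≤o N₁ N₂
        compare : Dec (seq x N ≤ seq y N + (δ + δ + δ)) → ∃ λ N → ∀ n → N ℕ.≤ n → seq x n ≤ seq y n + ε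
        compare (yes x≤) = N , λ n N≤n → subst (λ z → seq x n ≤ seq y n + z) (sym ε≡8δ)
          (≤-diff (seq x N + δ - seq x n + (seq y n + δ - seq y N) + (seq y N + (δ + δ + δ) - seq x N) + (δ + δ + δ))
            (+-≥0 (+-≥0 (+-≥0
              (diff-≥0 (∣p-q∣<ε⇒p≤q+ε (seq x n) (seq x N) (hx n N (N₁≤ N≤n) (N₁≤ ℕ.≤-refl))))
              (diff-≥0 (∣p-q∣<ε⇒p≤q+ε (seq y N) (seq y n) (hy N n (N₂≤ ℕ.≤-refl) (N₂≤ N≤n)))))
              (diff-≥0 x≤)) (+-≥0 (+-≥0 0≤δ 0≤δ) 0≤δ))
            (solve 5 (λ xn yn xN yN d → yn :+ (d :+ d :+ (d :+ d) :+ (d :+ d :+ (d :+ d))) :=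
               xn :+ (xN :+ d :- xn :+ (yn :+ d :- yN) :+ (yN :+ (d :+ d :+ d) :- xN) :+ (d :+ d :+ d)))
               refl (seq x n) (seq y n) (seq x N) (seq y N) δ))
        compare (no x≰) = contradiction (δ , 0<δ , N , λ n N≤n →
          ≤-diff (seq x n + δ - seq x N + (seq y N + δ - seq y n) + (seq x N - (seq y N + (δ + δ + δ))))
            (+-≥0 (+-≥0
              (diff-≥0 (∣p-q∣<ε⇒p≤q+ε (seq x N) (seq x n) (hx N n (N₁≤ ℕ.≤-refl) (N₁≤ N≤n))))
              (diff-≥0 (∣p-q∣<ε⇒p≤q+ε (seq y n) (seq y N) (hy n N (N₂≤ N≤n) (N₂≤ ℕ.≤-refl)))))
              (diff-≥0 (ℚ.<⇒≤ (ℚ.≰⇒> x≰))))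
            (solve 5 (λ xn yn xN yN d → xn :=
               yn :+ d :+ (xn :+ d :- xN :+ (yN :+ d :- yn) :+ (xN :- (yN :+ (d :+ d :+ d)))))
               refl (seq x n) (seq y n) (seq x N) (seq y N) δ)) y≮x

  ≤-⊓ : ∀ {x y z} → x ℝ.≤ y → x ℝ.≤ z → x ℝ.≤ y ℝ.⊓ z
  ≤-⊓ {x} {y} {z} x≤y x≤z ε 0<ε with x≤y ε 0<ε | x≤z ε 0<ε
  ... | N₁ , hy | N₂ , hz = N₁ ℕ.⊔ N₂ , bound
    where
    bound : ∀ n → N₁ ℕ.⊔ N₂ ℕ.≤ n → seq x n ≤ (seq y n ℚ.⊓ seq z n) + ε
    bound n N≤n with ℚ.⊓-sel (seq y n) (seq z n)
    ... | inj₁ eq = subst (λ w → seq x n ≤ w + ε) (sym eq) (hy n (ℕ.m⊔n≤o⇒m≤o N₁ N₂ N≤n))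
    ... | inj₂ eq = subst (λ w → seq x n ≤ w + ε) (sym eq) (hz n (ℕ.m⊔n≤o⇒n≤o N₁ N₂ N≤n))

  -- Classical existence of minima, maxima and floors

  ¬¬minimum : ∀ {P : ℕ → Set} e → P e → ¬ ¬ ∃ (IsMinimum P)
  ¬¬minimum {P} = <-rec (λ e → P e → ¬ ¬ ∃ (IsMinimum P)) λ e rec Pe none →
    none (e , Pe , λ e′ Pe′ → ℕ.≮⇒≥ λ e′<e → rec e′<e Pe′ none)

  -- A bound that is attained is the maximum; otherwise it can be lowered by one. Refuting `none`
  -- takes no decision between the two cases.
  ¬¬maximum : ∀ {P : ℕ → Set} B → (∀ e → P e → e ℕ.≤ B) → ∃ P → ¬ ¬ ∃ (IsMaximum P)
  ¬¬maximum zero    bnd (e , Pe) none = none (e , Pe , λ e′ Pe′ → ℕ.≤-trans (bnd e′ Pe′) z≤n)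
  ¬¬maximum {P} (suc B) bnd some none = ¬¬maximum B
    (λ e Pe → ℕ.≤-pred (ℕ.≤∧≢⇒< (bnd e Pe) λ { refl → none (e , Pe , bnd) }))
    some none

  -- Descends from the upper bound: were x < k + 1, the induction hypothesis would apply, and the
  -- failure of x < k + 1 is k + 1 ≤ x by `≮⇒≤`.
  ¬¬floor : ∀ {x} k → ι 0 ℝ.≤ x → x ℝ.< ι (suc k) → ¬ ¬ ∃ λ m → m ℕ.≤ k × IsFloor x m
  ¬¬floor         zero    0≤x x<1   none = none (0 , z≤n , 0≤x , x<1)
  ¬¬floor {x} (suc k) 0≤x x<k+2 none = none (suc k , ℕ.≤-refl , ≮⇒≤ {ι (suc k)} {x} x≮k+1 , x<k+2)
    where
    x≮k+1 : ¬ (x ℝ.< ι (suc k))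
    x≮k+1 x<k+1 = ¬¬floor {x} k 0≤x x<k+1 λ (m , m≤k , floor) → none (m , ℕ.m≤n⇒m≤1+n m≤k , floor)

  -- `K_{2,s+1}` has an edge. Hence every graph has some distance to the property, and a minimum can
  -- be sought.
  emptyGraph-Has : ∀ s n → Has (ℋ (suc s)) (emptyGraph n)
  emptyGraph-Has s n ind with _InducedIn_.preserves ind zero (suc (suc zero))
  ... | ()

  ¬¬distTo : ∀ s {n} (G : Graph n) → ¬ ¬ ∃ (IsDistTo (ℋ (suc s)) G)
  ¬¬distTo s {n} G = ¬¬minimum (dist G (emptyGraph n)) (emptyGraph n , emptyGraph-Has s n , refl)

  ¬¬maxDist : ∀ s {n m} → m ℕ.≤ n C 2 → ¬ ¬ ∃ (IsMaxDist (ℋ (suc s)) n m)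
  ¬¬maxDist s {n} {m} m≤ none with graphWithEdges n m m≤
  ... | G , ∣G∣ = ¬¬distTo s G λ (d , isDist) → ¬¬maximum (n C 2)
    (λ { e (G′ , _ , (G″ , _ , refl) , _) → ∣E∣≤nC2 (G′ △ G″) }) (d , G , ∣G∣ , isDist) none

  -- Bounds for finite graphs in terms of the density

  fromℕ-∸ : ∀ {m n} → m ℕ.≤ n → fromℕ (n ℕ.∸ m) ≡ fromℕ n - fromℕ m
  fromℕ-∸ {m} {n} m≤n = begin
    fromℕ (n ℕ.∸ m)                         ≡⟨ solve 2 (λ a b → b := a :+ b :- a) refl (fromℕ m) _ ⟩
    fromℕ m + fromℕ (n ℕ.∸ m) - fromℕ m     ≡⟨ cong (_- fromℕ m) (fromℕ-+ m (n ℕ.∸ m)) ⟨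
    fromℕ (m ℕ.+ (n ℕ.∸ m)) - fromℕ m       ≡⟨ cong (λ z → fromℕ z - fromℕ m) (ℕ.m+[n∸m]≡n m≤n) ⟩
    fromℕ n - fromℕ m                       ∎
    where
    open ≡-Reasoning
    open +-*-Solver

  -- f bounds the normalised distance to Forb(K_{2,s+1}) in terms of the edge density.
  Bound : ℕ → (ℚ → ℚ) → Set
  Bound s f = ∀ {n} .{{_ : NonZero (n C 2)}} m d → IsMaxDist (ℋ (suc s)) n m d →
    fromℕ d * 1/ℕ (n C 2) ≤ f (fromℕ m * 1/ℕ (n C 2))

  module _ where
    open ≡-Reasoning
    open +-*-Solver

    -- `c` and `κ` are the reciprocals of `N` and `K`, known only through equations that the ring
    -- solver cannot use. So vanishing terms built from `1ℚ` are inserted, and the ones are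
    -- rewritten to `N * c` and `K * κ`.
    rescale-matrix : ∀ {N c K κ M W D} → N * c ≡ 1ℚ → K * κ ≡ 1ℚ → 0ℚ ≤ c → 0ℚ ≤ κ →
      K * D ≤ M * W + (N - M) → D * c ≤ (W * (M * c) + (1ℚ - M * c)) * κ
    rescale-matrix {N} {c} {K} {κ} {M} {W} {D} Nc≡1 Kκ≡1 0≤c 0≤κ le =
      ≤-diff (c * κ * (M * W + (N - M) - K * D)) (*-≥0 (*-≥0 0≤c 0≤κ) (diff-≥0 le)) (begin
        (W * (M * c) + (1ℚ - M * c)) * κ
          ≡⟨ solve 5 (λ w m c k d → (w :* (m :* c) :+ (con 1ℚ :- m :* c)) :* k :=
               (w :* (m :* c) :+ (con 1ℚ :- m :* c)) :* k :+ (con 1ℚ :- con 1ℚ) :* (d :* c)) refl W M c κ D ⟩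
        (W * (M * c) + (1ℚ - M * c)) * κ + (1ℚ - 1ℚ) * (D * c)
          ≡⟨ cong₂ (λ u v → (W * (M * c) + (u - M * c)) * κ + (1ℚ - v) * (D * c)) (sym Nc≡1) (sym Kκ≡1) ⟩
        (W * (M * c) + (N * c - M * c)) * κ + (1ℚ - K * κ) * (D * c)
          ≡⟨ solve 7 (λ w m c N k K d → (w :* (m :* c) :+ (N :* c :- m :* c)) :* k :+ (con 1ℚ :- K :* k) :* (d :* c)
               := d :* c :+ c :* k :* (m :* w :+ (N :- m) :- K :* d)) refl W M c N κ K D ⟩
        D * c + c * κ * (M * W + (N - M) - K * D) ∎)

    rescale-split : ∀ {N c M D} → N * c ≡ 1ℚ → 0ℚ ≤ c →
      N * (N * D) ≤ M * (N - M) * N → D * c ≤ M * c * (1ℚ - M * c)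
    rescale-split {N} {c} {M} {D} Nc≡1 0≤c le =
      ≤-diff (c * c * c * (M * (N - M) * N - N * (N * D))) (*-≥0 (*-≥0 (*-≥0 0≤c 0≤c) 0≤c) (diff-≥0 le)) (begin
        M * c * (1ℚ - M * c)
          ≡⟨ solve 3 (λ m c d → m :* c :* (con 1ℚ :- m :* c) :=
               m :* c :* (con 1ℚ :- m :* c) :* con 1ℚ :+ d :* c :* (con 1ℚ :- con 1ℚ :* con 1ℚ)) refl M c D ⟩
        M * c * (1ℚ - M * c) * 1ℚ + D * c * (1ℚ - 1ℚ * 1ℚ)
          ≡⟨ cong (λ u → M * c * (u - M * c) * u + D * c * (1ℚ - u * u)) (sym Nc≡1) ⟩
        M * c * (N * c - M * c) * (N * c) + D * c * (1ℚ - (N * c) * (N * c))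
          ≡⟨ solve 4 (λ m c N d → m :* c :* (N :* c :- m :* c) :* (N :* c) :+ d :* c :* (con 1ℚ :- (N :* c) :* (N :* c))
               := d :* c :+ c :* c :* c :* (m :* (N :- m) :* N :- N :* (N :* d))) refl M c N D ⟩
        D * c + c * c * c * (M * (N - M) * N - N * (N * D)) ∎)

  matrix-bound : ∀ {k s w} → GreyMatrix (suc k) s w →
    Bound s (λ x → (fromℕ w * x + (1ℚ - x)) * 1/ℕ (suc k))
  matrix-bound {k} {s} {w} M {n} m d ((G , ∣G∣≡m , _ , d-min) , _) = rescale-matrix
    {N = fromℕ (n C 2)} {1/ℕ (n C 2)} {fromℕ (suc k)} {1/ℕ (suc k)} {fromℕ m} {fromℕ w} {fromℕ d}
    (fromℕ-1/ (n C 2)) (fromℕ-1/ (suc k)) (0≤1/ℕ (n C 2)) (0≤1/ℕ (suc k))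
    (subst₂ _≤_ (fromℕ-* (suc k) d)
      (trans (fromℕ-+ (m ℕ.* w) _) (cong₂ _+_ (fromℕ-* m w) (fromℕ-∸ m≤)))
      (fromℕ-mono le))
    where
    m≤ : m ℕ.≤ n C 2
    m≤ = subst (ℕ._≤ n C 2) ∣G∣≡m (∣E∣≤nC2 G)
    le : suc k ℕ.* d ℕ.≤ m ℕ.* w ℕ.+ (n C 2 ℕ.∸ m)
    le = let G′ , has , near = matrix-dist M G in
      subst (λ m → suc k ℕ.* d ℕ.≤ m ℕ.* w ℕ.+ (n C 2 ℕ.∸ m)) ∣G∣≡m
        (ℕ.≤-trans (ℕ.*-monoʳ-≤ (suc k) (d-min _ (G′ , has , refl))) near)

  split-bound : ∀ s → Bound (suc s) (λ x → x * (1ℚ - x))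
  split-bound s {n} m d ((G , ∣G∣≡m , _ , d-min) , _) = rescale-split
    {N = fromℕ (n C 2)} {1/ℕ (n C 2)} {fromℕ m} {fromℕ d} (fromℕ-1/ (n C 2)) (0≤1/ℕ (n C 2))
    (subst₂ _≤_ (trans (fromℕ-* (n C 2) _) (cong (fromℕ (n C 2) *_) (fromℕ-* (n C 2) d)))
      (trans (fromℕ-* (m ℕ.* (n C 2 ℕ.∸ m)) (n C 2)) (cong (_* fromℕ (n C 2))
        (trans (fromℕ-* m _) (cong (fromℕ m *_) (fromℕ-∸ m≤)))))
      (fromℕ-mono le))
    where
    m≤ : m ℕ.≤ n C 2
    m≤ = subst (ℕ._≤ n C 2) ∣G∣≡m (∣E∣≤nC2 G)
    le : (n C 2) ℕ.* ((n C 2) ℕ.* d) ℕ.≤ m ℕ.* (n C 2 ℕ.∸ m) ℕ.* (n C 2)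
    le = let G′ , has , near = split-dist s G in
      subst (λ m → (n C 2) ℕ.* ((n C 2) ℕ.* d) ℕ.≤ m ℕ.* (n C 2 ℕ.∸ m) ℕ.* (n C 2)) ∣G∣≡m
        (ℕ.≤-trans (ℕ.*-monoʳ-≤ (n C 2) (ℕ.*-monoʳ-≤ (n C 2) (d-min _ (G′ , has , refl)))) near)

  density≤1 : ∀ {m} C .{{_ : NonZero C}} → m ℕ.≤ C → fromℕ m * 1/ℕ C ≤ 1ℚ
  density≤1 {m} C m≤C = subst (fromℕ m * 1/ℕ C ≤_) (fromℕ-1/ C)
    (ℚ.*-monoʳ-≤-nonNeg (1/ℕ C) {{ℚ.nonNegative (0≤1/ℕ C)}} (fromℕ-mono m≤C))

  Bound-both : ∀ {s f g h} → Bound s f → Bound s g →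
    (∀ x d → 0ℚ ≤ x → x ≤ 1ℚ → d ≤ f x → d ≤ g x → d ≤ h x) → Bound s h
  Bound-both bf bg f∧g⇒h {n} m d max@((G , refl , _) , _) =
    f∧g⇒h _ _ (*-≥0 (0≤fromℕ m) (0≤1/ℕ (n C 2))) (density≤1 (n C 2) (∣E∣≤nC2 G)) (bf m d max) (bg m d max)

  -- Passing to the limit

  -- `x` stands for an actual density and stays in [0,1]; `y` stands for a rational approximation of
  -- `p` and may leave it.
  Lipschitz : (ℚ → ℚ) → ℚ → Set
  Lipschitz f L = ∀ x y η → 0ℚ ≤ x → x ≤ 1ℚ → x ≤ y + η → y ≤ x + η → η ≤ 1ℚ → f x ≤ f y + L * η

  module _ where
    open +-*-Solver

    increasing-Lipschitz : ∀ s d .{{_ : NonZero d}} →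
      Lipschitz (λ x → (1ℚ + fromℕ s * x) * 1/ℕ d) (fromℕ s * 1/ℕ d)
    increasing-Lipschitz s d x y η _ _ x≤ _ _ = ≤-diff (fromℕ s * 1/ℕ d * (y + η - x))
      (*-≥0 (*-≥0 (0≤fromℕ s) (0≤1/ℕ d)) (diff-≥0 x≤))
      (solve 5 (λ s k x y e → (con 1ℚ :+ s :* y) :* k :+ s :* k :* e :=
         (con 1ℚ :+ s :* x) :* k :+ s :* k :* (y :+ e :- x)) refl (fromℕ s) (1/ℕ d) x y η)

    decreasing-Lipschitz : ∀ d .{{_ : NonZero d}} → Lipschitz (λ x → (1ℚ - x) * 1/ℕ d) (1/ℕ d)
    decreasing-Lipschitz d x y η _ _ _ y≤ _ = ≤-diff (1/ℕ d * (x + η - y))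
      (*-≥0 (0≤1/ℕ d) (diff-≥0 y≤))
      (solve 4 (λ k x y e → (con 1ℚ :- y) :* k :+ k :* e :=
         (con 1ℚ :- x) :* k :+ k :* (x :+ e :- y)) refl (1/ℕ d) x y η)

    -- The difference is (x - y)(1 - x - y), and |1 - x - y| ≤ |1 - 2x| + |x - y| ≤ 1 + η ≤ 2.
    split-Lipschitz : Lipschitz (λ x → x * (1ℚ - x)) (1ℚ + 1ℚ)
    split-Lipschitz x y η 0≤x x≤1 x≤ y≤ η≤1 = ≤-diff
      ((1ℚ - x) * A + x * B + A * B + η * (1ℚ - η))
      (+-≥0 (+-≥0 (+-≥0 (*-≥0 (diff-≥0 x≤1) 0≤A) (*-≥0 0≤x 0≤B)) (*-≥0 0≤A 0≤B))
            (*-≥0 0≤η (diff-≥0 η≤1)))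
      (solve 3 (λ x y e → let a = y :+ e :- x ; b = x :+ e :- y in
         y :* (con 1ℚ :- y) :+ (con 1ℚ :+ con 1ℚ) :* e :=
         x :* (con 1ℚ :- x) :+ ((con 1ℚ :- x) :* a :+ x :* b :+ a :* b :+ e :* (con 1ℚ :- e))) refl x y η)
      where
      A = y + η - x
      B = x + η - y
      0≤A : 0ℚ ≤ A
      0≤A = diff-≥0 x≤
      0≤B : 0ℚ ≤ B
      0≤B = diff-≥0 y≤
      0≤η : 0ℚ ≤ η
      0≤η = subst (0ℚ ≤_) (solve 3 (λ x y e → con ½ :* (y :+ e :- x :+ (x :+ e :- y)) := e) refl x y η)
        (*-≥0 (ℚ.nonNegative⁻¹ ½) (+-≥0 0≤A 0≤B))

  n≤[1+n]C2 : ∀ n → n ℕ.≤ suc n C 2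
  n≤[1+n]C2 n = subst (n ℕ.≤_) (trans (cong (ℕ._+ n C 2) (sym (nC1≡n n))) (nCk+nC[k+1]≡[n+1]C[k+1] n 1))
                      (ℕ.m≤m+n n (n C 2))

  module _ {p : ℝ} (0≤p : ι 0 ℝ.≤ p) (p≤1 : p ℝ.≤ ι 1) (C : ℕ) .{{_ : NonZero C}} where
    open +-*-Solver

    private
      c = 1/ℕ C
      Cc≡1 = fromℕ-1/ C

    0≤pC : ι 0 ℝ.≤ p ℝ.* ι C
    0≤pC ε 0<ε with 0≤p (ε * c) (*->0 0<ε (0<1/ℕ C))
    ... | N , h = N , λ n N≤n → ≤-diff ((seq p n + ε * c - 0ℚ) * fromℕ C)
      (*-≥0 (diff-≥0 (h n N≤n)) (0≤fromℕ C))
      (trans (trans (solve 3 (λ x C e → x :* C :+ e := x :* C :+ e :* con 1ℚ) refl (seq p n) (fromℕ C) ε)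
                    (cong (λ u → seq p n * fromℕ C + ε * u) (sym Cc≡1)))
        (solve 4 (λ x e C c → x :* C :+ e :* (C :* c) := con 0ℚ :+ (x :+ e :* c :- con 0ℚ) :* C)
          refl (seq p n) ε (fromℕ C) c))

    pC<1+C : p ℝ.* ι C ℝ.< ι (suc C)
    -- Approximations of `p` may exceed 1, eventually by at most 1/(2C); multiplied by `C` this
    -- costs ½ and leaves a gap of ½.
    pC<1+C with p≤1 (½ * c) (*->0 (ℚ.positive⁻¹ ½) (0<1/ℕ C))
    ... | N , h = ½ , ℚ.positive⁻¹ ½ , N , λ n N≤n → ≤-diff ((1ℚ + ½ * c - seq p n) * fromℕ C)
      (*-≥0 (diff-≥0 (h n N≤n)) (0≤fromℕ C))
      (trans (fromℕ-+ 1 C) (trans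
        (solve 1 (λ C → con 1ℚ :+ C := C :+ con ½ :+ con ½ :* con 1ℚ) refl (fromℕ C))
        (trans (cong (λ u → fromℕ C + ½ + ½ * u) (sym Cc≡1))
          (solve 3 (λ x C c → C :+ con ½ :+ con ½ :* (C :* c) :=
            x :* C :+ con ½ :+ (con 1ℚ :+ con ½ :* c :- x) :* C) refl (seq p n) (fromℕ C) c))))

    -- The floor is within 1 of pC. Its lower half m ≤ pC holds for approximations only up to a
    -- tolerance; tolerance 1 equals the rounding error of the other half, so `c` covers both.
    density-near : ∀ {m} → IsFloor (p ℝ.* ι C) m → ∃ λ N → ∀ i → N ℕ.≤ i →
      fromℕ m * c ≤ seq p i + c × seq p i ≤ fromℕ m * c + c
    density-near {m} (m≤pC , ε , 0<ε , N₂ , pC<m+1) with m≤pC 1ℚ (ℚ.positive⁻¹ 1ℚ)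
    ... | N₁ , h = N₁ ℕ.⊔ N₂ , λ i N≤i →
        ≤-diff ((seq p i * fromℕ C + 1ℚ - fromℕ m) * c)
          (*-≥0 (diff-≥0 (h i (ℕ.m⊔n≤o⇒m≤o N₁ N₂ N≤i))) (0≤1/ℕ C))
          (trans (solve 2 (λ x c → x :+ c := x :* con 1ℚ :+ c) refl (seq p i) c)
            (trans (cong (λ u → seq p i * u + c) (sym Cc≡1))
              (solve 4 (λ x C c m → x :* (C :* c) :+ c := m :* c :+ (x :* C :+ con 1ℚ :- m) :* c)
                refl (seq p i) (fromℕ C) c (fromℕ m))))
      , ≤-diff ((fromℕ (suc m) - (seq p i * fromℕ C + ε) + ε) * c)
          (*-≥0 (+-≥0 (diff-≥0 (pC<m+1 i (ℕ.m⊔n≤o⇒n≤o N₁ N₂ N≤i))) (ℚ.<⇒≤ 0<ε)) (0≤1/ℕ C))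
          (trans (solve 3 (λ x c m → m :* c :+ c := x :+ ((con 1ℚ :+ m) :* c :- x :* con 1ℚ))
                   refl (seq p i) c (fromℕ m))
            (trans (cong₂ (λ u v → seq p i + (v * c - seq p i * u)) (sym Cc≡1) (sym (fromℕ-+ 1 m)))
              (solve 5 (λ x C c m e → x :+ (m :* c :- x :* (C :* c)) :=
                 x :+ (m :- (x :* C :+ e) :+ e) :* c)
                refl (seq p i) (fromℕ C) c (fromℕ (suc m)) ε)))

  module _ where
    open +-*-Solver

    -- With `i` = 1/ε and `N` = C(n,2), a bound `K` for L/ε tells how large C(n,2) has to be.
    slope-small : ∀ {L ε N c i K} → ε * i ≡ 1ℚ → N * c ≡ 1ℚ → 0ℚ ≤ ε → 0ℚ ≤ c →
      L * i ≤ K → K ≤ N → L * c ≤ ε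
    slope-small {L} {ε} {N} {c} {i} εi≡1 Nc≡1 0≤ε 0≤c Li≤K K≤N = ≤-diff (ε * (c * (N - L * i)))
      (*-≥0 0≤ε (*-≥0 0≤c (diff-≥0 (ℚ.≤-trans Li≤K K≤N))))
      (trans (solve 3 (λ e L c → e := e :* con 1ℚ :+ L :* c :* (con 1ℚ :- con 1ℚ)) refl ε L c)
        (trans (cong₂ (λ u v → ε * u + L * c * (1ℚ - v)) (sym Nc≡1) (sym εi≡1))
          (solve 5 (λ e L c N i → e :* (N :* c) :+ L :* c :* (con 1ℚ :- e :* i) :=
             L :* c :+ e :* (c :* (N :- L :* i))) refl ε L c N i)))

    -- The chain e ≤ y + γ/4 ≤ u + γ/4 ≤ b + γ/2 < b + γ. `θ` is the margin in the strict inequality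
    -- of reals.
    gap-too-small : ∀ {γ y e b u v θ δ} → 0ℚ < γ → 0ℚ ≤ θ → ∣ y - e ∣ + θ ≤ ½ * (½ * γ) →
      y ≤ u → u ≤ v + δ → δ ≤ ½ * (½ * γ) → v ≡ b → ¬ (b + γ ≤ e)
    gap-too-small {γ} {y} {e} {b} {u} {θ = θ} {δ} 0<γ 0≤θ y≈e y≤u u≤v+δ δ≤ε refl b+γ≤e =
      ℚ.<-irrefl refl (ℚ.≤-<-trans b+γ≤e (ℚ.≤-<-trans e≤ b+½γ<b+γ))
      where
      ε = ½ * (½ * γ)
      e≤y+ε : e ≤ y + ε
      e≤y+ε = ∣p-q∣≤ε⇒q≤p+ε y e (≤-diff (ε - (∣ y - e ∣ + θ) + θ) (+-≥0 (diff-≥0 y≈e) 0≤θ)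
        (solve 3 (λ e a t → e := a :+ (e :- (a :+ t) :+ t)) refl ε ∣ y - e ∣ θ))
      e≤ : e ≤ b + ½ * γ
      e≤ = ≤-diff (y + ε - e + (u - y) + (b + δ - u) + (ε - δ))
        (+-≥0 (+-≥0 (+-≥0 (diff-≥0 e≤y+ε) (diff-≥0 y≤u)) (diff-≥0 u≤v+δ)) (diff-≥0 δ≤ε))
        (solve 6 (λ b g y e u d → b :+ con ½ :* g :=
           e :+ (y :+ con ½ :* (con ½ :* g) :- e :+ (u :- y) :+ (b :+ d :- u) :+ (con ½ :* (con ½ :* g) :- d)))
           refl b γ y e u δ)
      b+½γ<b+γ : b + ½ * γ < b + γ
      b+½γ<b+γ = ℚ.+-monoʳ-< b (subst₂ _<_ (ℚ.+-identityʳ (½ * γ)) (sym (halves γ))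
        (ℚ.+-monoʳ-< (½ * γ) (*->0 (ℚ.positive⁻¹ ½) 0<γ)))

  1/ℕ≤1 : ∀ n .{{_ : NonZero n}} → 1/ℕ n ≤ 1ℚ
  1/ℕ≤1 n = subst (_≤ 1ℚ) (ℚ.*-identityˡ (1/ℕ n)) (density≤1 {1} n (ℕ.>-nonZero⁻¹ n))

  module _ {s} f L (bound : Bound s f) (lip : Lipschitz f L) (p b e : ℝ)
           (0≤p : ι 0 ℝ.≤ p) (p≤1 : p ℝ.≤ ι 1) (f≗b : ∀ i → f (seq p i) ≡ seq b i) where

    gap-contradiction : ∀ {γ N₀} → 0ℚ < γ → (∀ i → N₀ ℕ.≤ i → seq b i + γ ≤ seq e i) →
      ∀ n .{{_ : NonZero (n C 2)}} → L * 1/ℕ (n C 2) ≤ ½ * (½ * γ) →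
      (∀ m d → IsFloor (p ℝ.* ι (n C 2)) m → IsMaxDist (ℋ (suc s)) n m d →
         abs (ι d ℝ./ (n C 2) ℝ.- e) ℝ.< fromℚ (½ * (½ * γ))) →
      ∀ m → m ℕ.≤ n C 2 → IsFloor (p ℝ.* ι (n C 2)) m → ¬ ∃ (IsMaxDist (ℋ (suc s)) n m)
    gap-contradiction {γ} {N₀} 0<γ b+γ≤e n Lc≤ε close m m≤ isFloor (d , isMax) =
      far (close m d isFloor isMax) (density-near {p} 0≤p p≤1 (n C 2) {m} isFloor)
      where
      c = 1/ℕ (n C 2)
      x = fromℕ m * c
      y = fromℕ d * c
      far : abs (ι d ℝ./ (n C 2) ℝ.- e) ℝ.< fromℚ (½ * (½ * γ)) →
            ¬ (∃ λ N → ∀ i → N ℕ.≤ i → x ≤ seq p i + c × seq p i ≤ x + c)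
      far (θ , 0<θ , N₁ , d≈e) (N₂ , x≈p) = gap-too-small
        {y = y} {e = seq e i} {b = seq b i} {u = f x} {v = f (seq p i)} {θ = θ} {δ = L * c}
        0<γ (ℚ.<⇒≤ 0<θ) (d≈e i N₁≤i) (bound m d isMax)
        (lip x (seq p i) c (*-≥0 (0≤fromℕ m) (0≤1/ℕ (n C 2)))
             (density≤1 (n C 2) m≤) (proj₁ (x≈p i N₂≤i)) (proj₂ (x≈p i N₂≤i)) (1/ℕ≤1 (n C 2)))
        Lc≤ε (f≗b i) (b+γ≤e i (ℕ.m≤m⊔n N₀ (N₁ ℕ.⊔ N₂)))
        where
        i = N₀ ℕ.⊔ (N₁ ℕ.⊔ N₂)
        N₁≤i : N₁ ℕ.≤ i
        N₁≤i = ℕ.≤-trans (ℕ.m≤m⊔n N₁ N₂) (ℕ.m≤n⊔m N₀ (N₁ ℕ.⊔ N₂))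
        N₂≤i : N₂ ℕ.≤ i
        N₂≤i = ℕ.≤-trans (ℕ.m≤n⊔m N₁ N₂) (ℕ.m≤n⊔m N₀ (N₁ ℕ.⊔ N₂))

    -- A gap γ between `b` and `e` is refuted at a single large `n`. The goal there is a
    -- contradiction, so a floor and a maximum may be assumed for that `n`.
    ed≤ : IsEd (ℋ (suc s)) p e → e ℝ.≤ b
    ed≤ isEd = ≮⇒≤ {e} {b} impossible
      where
      impossible : ¬ (b ℝ.< e)
      impossible (γ , 0<γ , N₀ , b+γ≤e) = choose (isEd ε 0<ε) (archimedean (L * ℚ.1/ ε))
        where
        ε = ½ * (½ * γ)
        0<ε : 0ℚ < ε
        0<ε = *->0 (ℚ.positive⁻¹ ½) (*->0 (ℚ.positive⁻¹ ½) 0<γ)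
        instance
          ε≢0 : ℚ.NonZero ε
          ε≢0 = ℚ.pos⇒nonZero ε {{ℚ.positive 0<ε}}
        at : ∀ {K} → L * ℚ.1/ ε ≤ fromℕ K → ∀ n → K ℕ.≤ n C 2 → .{{_ : NonZero (n C 2)}} →
          ¬ (∀ m d → IsFloor (p ℝ.* ι (n C 2)) m → IsMaxDist (ℋ (suc s)) n m d →
               abs (ι d ℝ./ (n C 2) ℝ.- e) ℝ.< fromℚ ε)
        at {K} L/ε≤K n K≤C close =
          ¬¬floor {p ℝ.* ι (n C 2)} (n C 2) (0≤pC {p} 0≤p p≤1 (n C 2)) (pC<1+C {p} 0≤p p≤1 (n C 2))
            λ (m , m≤ , isFloor) → ¬¬maxDist s m≤
              (gap-contradiction 0<γ b+γ≤e n Lc≤ε close m m≤ isFloor)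
          where
          Lc≤ε : L * 1/ℕ (n C 2) ≤ ε
          Lc≤ε = slope-small {L = L} {K = fromℕ K} (ℚ.*-inverseʳ ε) (fromℕ-1/ (n C 2)) (ℚ.<⇒≤ 0<ε) (0≤1/ℕ (n C 2))
                             L/ε≤K (fromℕ-mono K≤C)
        choose : (∃ λ N → ∀ n → N ℕ.≤ n → .{{_ : NonZero (n C 2)}} → ∀ m d →
                   IsFloor (p ℝ.* ι (n C 2)) m → IsMaxDist (ℋ (suc s)) n m d →
                   abs (ι d ℝ./ (n C 2) ℝ.- e) ℝ.< fromℚ ε) →
                 ¬ (∃ λ K → L * ℚ.1/ ε ≤ fromℕ K)
        choose (N , close) (K , L/ε≤K) = at L/ε≤K n (ℕ.≤-trans (ℕ.m≤n+m K N) (ℕ.<⇒≤ N+K<C)) {{C≢0}}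
          (close n (ℕ.m≤n⇒m≤1+n (ℕ.m≤n⇒m≤1+n (ℕ.m≤m+n N K))) {{C≢0}})
          where
          -- As C(n,2) ≥ n - 1, adding 2 makes C(n,2) exceed `K` and be nonzero.
          n = suc (suc (N ℕ.+ K))
          N+K<C : N ℕ.+ K ℕ.< n C 2
          N+K<C = n≤[1+n]C2 (suc (N ℕ.+ K))
          C≢0 : NonZero (n C 2)
          C≢0 = ℕ.>-nonZero (ℕ.≤-<-trans z≤n N+K<C)

  -- Lines and their convex combinations

  Bound-≗ : ∀ {s f g} → Bound s f → (∀ x → f x ≡ g x) → Bound s g
  Bound-≗ bf f≗g {n} m d max = subst (fromℕ d * 1/ℕ (n C 2) ≤_) (f≗g _) (bf m d max)

  increasing-bound : ∀ {k s w} → GreyMatrix (suc k) s (suc w) →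
    Bound s (λ x → (1ℚ + fromℕ w * x) * 1/ℕ (suc k))
  increasing-bound {k} {w = w} M = Bound-≗ (matrix-bound M) λ x →
    trans (cong (λ z → (z * x + (1ℚ - x)) * 1/ℕ (suc k)) (fromℕ-+ 1 w))
      (solve 3 (λ w x k → ((con 1ℚ :+ w) :* x :+ (con 1ℚ :- x)) :* k := (con 1ℚ :+ w :* x) :* k)
        refl (fromℕ w) x (1/ℕ (suc k)))
    where open +-*-Solver

  decreasing-bound : ∀ {k s} → GreyMatrix (suc k) s 0 → Bound s (λ x → (1ℚ - x) * 1/ℕ (suc k))
  decreasing-bound {k} M = Bound-≗ (matrix-bound M) λ x →
    solve 2 (λ x k → (con 0ℚ :* x :+ (con 1ℚ :- x)) :* k := (con 1ℚ :- x) :* k) refl x (1/ℕ (suc k))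
    where open +-*-Solver

  -- The slack between `h` and the combination is linear, hence nonnegative on [0,1] once its values
  -- α at 0 and β at 1 are.
  Bound-mix : ∀ {s} f g h u v α β
    .{{_ : ℚ.NonNegative u}} .{{_ : ℚ.NonNegative v}} .{{_ : ℚ.NonNegative α}} .{{_ : ℚ.NonNegative β}} →
    u + v ≡ 1ℚ → (∀ x → h x ≡ u * f x + v * g x + (α * (1ℚ - x) + β * x)) →
    Bound s f → Bound s g → Bound s h
  Bound-mix f g h u v α β u+v≡1 h≗ bf bg = Bound-both {f = f} {g} {h} bf bg λ x d 0≤x x≤1 d≤f d≤g →
    ≤-diff (u * (f x - d) + v * (g x - d) + (α * (1ℚ - x) + β * x))
      (+-≥0 (+-≥0 (*-≥0 (ℚ.nonNegative⁻¹ u) (diff-≥0 d≤f)) (*-≥0 (ℚ.nonNegative⁻¹ v) (diff-≥0 d≤g)))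
            (+-≥0 (*-≥0 (ℚ.nonNegative⁻¹ α) (diff-≥0 x≤1)) (*-≥0 (ℚ.nonNegative⁻¹ β) 0≤x)))
      (begin
        h x
          ≡⟨ h≗ x ⟩
        u * f x + v * g x + r x
          ≡⟨ solve 6 (λ u v f g r d → u :* f :+ v :* g :+ r :=
               (u :+ v) :* d :+ (u :* (f :- d) :+ v :* (g :- d) :+ r)) refl u v (f x) (g x) (r x) d ⟩
        (u + v) * d + (u * (f x - d) + v * (g x - d) + r x)
          ≡⟨ cong (λ z → z * d + (u * (f x - d) + v * (g x - d) + r x)) u+v≡1 ⟩
        1ℚ * d + (u * (f x - d) + v * (g x - d) + r x)
          ≡⟨ cong (_+ (u * (f x - d) + v * (g x - d) + r x)) (ℚ.*-identityˡ d) ⟩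
        d + (u * (f x - d) + v * (g x - d) + r x) ∎)
    where
    open ≡-Reasoning
    open +-*-Solver
    r : ℚ → ℚ
    r x = α * (1ℚ - x) + β * x

  -- The lines with denominators 49 and 76 belong to the parameter sets
  -- (49,16,3,6) and (76,21,2,7), for which no strongly regular graph exists.  On
  -- [0,1] they lie above convex combinations of lines given by other graphs.
  bound₄₉ : Bound 6 (λ x → (1ℚ + fromℕ 31 * x) * 1/ℕ 49)
  bound₄₉ = Bound-mix (λ x → (1ℚ + fromℕ 30 * x) * 1/ℕ 48) (λ x → (1ℚ + fromℕ 44 * x) * 1/ℕ 64) (λ x → (1ℚ + fromℕ 31 * x) * 1/ℕ 49) u v α β refl (λ x → solve 1 (λ x →
      (con 1ℚ :+ con (fromℕ 31) :* x) :* con (1/ℕ 49) :=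
      con u :* ((con 1ℚ :+ con (fromℕ 30) :* x) :* con (1/ℕ 48)) :+
      con v :* ((con 1ℚ :+ con (fromℕ 44) :* x) :* con (1/ℕ 64)) :+
      (con α :* (con 1ℚ :- x) :+ con β :* x)) refl x)
    (increasing-bound grey₄₈) (increasing-bound grey₆₄)
    where
    open +-*-Solver
    u v α β : ℚ
    u = ℤ.+ 7 ℚ./ 8
    v = ℤ.+ 1 ℚ./ 8
    -- The slacks at the two ends are 1/49 - 31/1536 and 32/49 - 1003/1536; the weights 7/8 and 1/8
    -- keep both positive.
    α = ℤ.+ 17 ℚ./ 75264
    β = ℤ.+ 5 ℚ./ 75264

  bound₇₆ : Bound 7 (λ x → (1ℚ + fromℕ 53 * x) * 1/ℕ 76)
  bound₇₆ = Bound-mix (λ x → (1ℚ + fromℕ 31 * x) * 1/ℕ 51) (λ x → (1ℚ + fromℕ 95 * x) * 1/ℕ 125) (λ x → (1ℚ + fromℕ 53 * x) * 1/ℕ 76) u v α β refl (λ x → solve 1 (λ x →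
      (con 1ℚ :+ con (fromℕ 53) :* x) :* con (1/ℕ 76) :=
      con u :* ((con 1ℚ :+ con (fromℕ 31) :* x) :* con (1/ℕ 51)) :+
      con v :* ((con 1ℚ :+ con (fromℕ 95) :* x) :* con (1/ℕ 125)) :+
      (con α :* (con 1ℚ :- x) :+ con β :* x)) refl x)
    (increasing-bound grey₅₁) (increasing-bound grey₁₂₅)
    where
    open +-*-Solver
    u v α β : ℚ
    u = ℤ.+ 3 ℚ./ 7
    v = ℤ.+ 4 ℚ./ 7
    α = ℤ.+ 207 ℚ./ 1130500
    β = ℤ.+ 223 ℚ./ 80750

  module DensityBounds (p : ℝ) (0≤p : ι 0 ℝ.≤ p) (p≤1 : p ℝ.≤ ι 1) (e : ℝ) where

    ed≤split : ∀ {s} → IsEd (ℋ (suc (suc s))) p e → e ℝ.≤ p ℝ.* (ι 1 ℝ.- p)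
    ed≤split {s} = ed≤ (λ x → x * (1ℚ - x)) (1ℚ + 1ℚ) (split-bound s) split-Lipschitz
      p (p ℝ.* (ι 1 ℝ.- p)) e 0≤p p≤1 λ _ → refl

    ed≤line : ∀ {s} w d .{{_ : NonZero d}} b → Bound s (λ x → (1ℚ + fromℕ w * x) * 1/ℕ d) →
      (∀ i → (1ℚ + fromℕ w * seq p i) * 1/ℕ d ≡ seq b i) → IsEd (ℋ (suc s)) p e → e ℝ.≤ b
    ed≤line w d b bound = ed≤ (λ x → (1ℚ + fromℕ w * x) * 1/ℕ d) (fromℕ w * 1/ℕ d)
      bound (increasing-Lipschitz w d) p b e 0≤p p≤1

    ed≤matrix : ∀ {k s w} → GreyMatrix (suc k) s (suc w) →
      IsEd (ℋ (suc s)) p e → e ℝ.≤ (ι 1 ℝ.+ ι w ℝ.* p) ℝ./ suc k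
    ed≤matrix {k} {w = w} M = ed≤line w (suc k) ((ι 1 ℝ.+ ι w ℝ.* p) ℝ./ suc k) (increasing-bound M) λ _ → refl

    -- One white edge per vertex on average makes the slope k - 2 - g vanish.
    ed≤constant : ∀ {k s} → GreyMatrix (suc k) s 1 → IsEd (ℋ (suc s)) p e → e ℝ.≤ ι 1 ℝ./ suc k
    ed≤constant {k} M = ed≤line 0 (suc k) (ι 1 ℝ./ suc k) (increasing-bound M) λ i →
      cong (_* 1/ℕ (suc k)) (trans (cong (_+_ 1ℚ) (ℚ.*-zeroˡ (seq p i))) (ℚ.+-identityʳ 1ℚ))

    ed≤complete : ∀ {k s} → GreyMatrix (suc k) s 0 → IsEd (ℋ (suc s)) p e → e ℝ.≤ (ι 1 ℝ.- p) ℝ./ suc k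
    ed≤complete {k} M = ed≤ (λ x → (1ℚ - x) * 1/ℕ (suc k)) (1/ℕ (suc k))
      (decreasing-bound M) (decreasing-Lipschitz (suc k)) p ((ι 1 ℝ.- p) ℝ./ suc k) e 0≤p p≤1 λ _ → refl

open EditDistance
open Recolouring
open import Defs
open import Data.List.Base using ([]; _∷_)

-- On an explicit list the `foldl` reduces to the left-nested minima of the theorem, so each bound
-- can stand next to its proof.
below-⨅ : ∀ x y (zs : List (Σ ℝ (x ≤_))) → x ≤ y → x ≤ foldl (λ y z → y ⊓ proj₁ z) y zs
below-⨅ x y []               x≤y = x≤y
below-⨅ x y ((z , x≤z) ∷ zs) x≤y = below-⨅ x (y ⊓ z) zs (≤-⊓ {x} {y} {z} x≤y x≤z)

theorem12 : (p : ℝ) → ι 0 ≤ p → p ≤ ι 1 →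
  (∀ e → IsEd (ℋ 5) p e → e ≤
    (p * (ι 1 - p)
     ⊓ (ι 1 + ι 75 * p) / 96
     ⊓ (ι 1 + ι 26 * p) / 40
     ⊓ (ι 1 + ι 5 * p) / 13
     ⊓ ι 1 / 6
     ⊓ (ι 1 - p) / 4))
  × (∀ e → IsEd (ℋ 6) p e → e ≤
    (p * (ι 1 - p)
     ⊓ (ι 1 + ι 63 * p) / 85
     ⊓ (ι 1 + ι 14 * p) / 26
     ⊓ (ι 1 + ι 7 * p) / 17
     ⊓ (ι 1 + ι 2 * p) / 10
     ⊓ (ι 1 - p) / 5))
  × (∀ e → IsEd (ℋ 7) p e → e ≤
    (p * (ι 1 - p)
     ⊓ (ι 1 + ι 124 * p) / 156
     ⊓ (ι 1 + ι 76 * p) / 100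
     ⊓ (ι 1 + ι 44 * p) / 64
     ⊓ (ι 1 + ι 31 * p) / 49
     ⊓ (ι 1 + ι 20 * p) / 36
     ⊓ (ι 1 + ι 5 * p) / 16
     ⊓ ι 1 / 8
     ⊓ (ι 1 - p) / 6))
  × (∀ e → IsEd (ℋ 8) p e → e ≤
    (p * (ι 1 - p)
     ⊓ (ι 1 + ι 124 * p) / 156
     ⊓ (ι 1 + ι 95 * p) / 125
     ⊓ (ι 1 + ι 53 * p) / 76
     ⊓ (ι 1 + ι 20 * p) / 36
     ⊓ (ι 1 + ι 11 * p) / 25
     ⊓ (ι 1 + ι 5 * p) / 16
     ⊓ (ι 3 * p + ι 1) / 13
     ⊓ (ι 1 - p) / 7))
theorem12 p 0≤p p≤1 =
  (λ e ed → below-⨅ e (p * (ι 1 - p))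
      ( ((ι 1 + ι 75 * p) / 96 , ed≤matrix e grey₉₆ ed)
      ∷ ((ι 1 + ι 26 * p) / 40 , ed≤matrix e grey₄₀ ed)
      ∷ ((ι 1 + ι 5 * p) / 13 , ed≤matrix e grey₁₃ ed)
      ∷ (ι 1 / 6 , ed≤constant e grey₆ ed)
      ∷ ((ι 1 - p) / 4 , ed≤complete e complete₄ ed)
      ∷ []) (ed≤split e ed))
  ,
  (λ e ed → below-⨅ e (p * (ι 1 - p))
      ( ((ι 1 + ι 63 * p) / 85 , ed≤matrix e grey₈₅ ed)
      ∷ ((ι 1 + ι 14 * p) / 26 , ed≤matrix e grey₂₆ ed)
      ∷ ((ι 1 + ι 7 * p) / 17 , ed≤matrix e grey₁₇ ed)
      ∷ ((ι 1 + ι 2 * p) / 10 , ed≤matrix e grey₁₀ ed)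
      ∷ ((ι 1 - p) / 5 , ed≤complete e complete₅ ed)
      ∷ []) (ed≤split e ed))
  ,
  (λ e ed → below-⨅ e (p * (ι 1 - p))
      ( ((ι 1 + ι 124 * p) / 156 , ed≤matrix e grey₁₅₆ ed)
      ∷ ((ι 1 + ι 76 * p) / 100 , ed≤matrix e grey₁₀₀ ed)
      ∷ ((ι 1 + ι 44 * p) / 64 , ed≤matrix e grey₆₄ ed)
      ∷ ((ι 1 + ι 31 * p) / 49 , ed≤line e 31 49 ((ι 1 + ι 31 * p) / 49) bound₄₉ (λ _ → refl) ed)
      ∷ ((ι 1 + ι 20 * p) / 36 , ed≤matrix e grey₃₆ ed)
      ∷ ((ι 1 + ι 5 * p) / 16 , ed≤matrix e grey₁₆ ed)
      ∷ (ι 1 / 8 , ed≤constant e grey₈ ed)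
      ∷ ((ι 1 - p) / 6 , ed≤complete e complete₆ ed)
      ∷ []) (ed≤split e ed))
  ,
  (λ e ed → below-⨅ e (p * (ι 1 - p))
      ( ((ι 1 + ι 124 * p) / 156 , ed≤matrix e grey₁₅₆′ ed)
      ∷ ((ι 1 + ι 95 * p) / 125 , ed≤matrix e grey₁₂₅ ed)
      ∷ ((ι 1 + ι 53 * p) / 76 , ed≤line e 53 76 ((ι 1 + ι 53 * p) / 76) bound₇₆ (λ _ → refl) ed)
      ∷ ((ι 1 + ι 20 * p) / 36 , ed≤matrix e grey₃₆′ ed)
      ∷ ((ι 1 + ι 11 * p) / 25 , ed≤matrix e grey₂₅ ed)
      ∷ ((ι 1 + ι 5 * p) / 16 , ed≤matrix e grey₁₆′ ed)
      ∷ ((ι 3 * p + ι 1) / 13 , ed≤line e 3 13 ((ι 3 * p + ι 1) / 13) (increasing-bound grey₁₃′)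
        (λ i → cong (ℚ._* (1/ℕ 13)) (ℚ.+-comm 1ℚ (fromℕ 3 ℚ.* seq p i))) ed)
      ∷ ((ι 1 - p) / 7 , ed≤complete e complete₇ ed)
      ∷ []) (ed≤split e ed))
  where open DensityBounds p 0≤p p≤1
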